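{- Let $\Delta\subset\mathbb{R}^2$ be a non-empty minimal lattice polygon and let $d=\operatorname{lw}(\Delta)$. Then $\Delta$ is unimodularly equivalent to a minimal polygon of one of the following forms: \begin{enumerate} \item[(T1)] $\operatorname{conv}\{(0,0),(d,y),(x,d)\}$ where $x,y\in\{0,\ldots,d\}$ satisfy $x+y\leq d$; \item[(T2)] $\operatorname{conv}\{(x_1,0),(d,y_2),(x_2,d),(0,y_1)\}$ where $x_1,x_2,y_1,y_2\in\{1,\ldots,d-1\}$ satisfy $\max(x_2,y_2)\geq\min(x_1,y_1)$ and $\max(d-x_2,y_1)\geq\min(d-x_1,y_2)$; \item[(T3)] $\operatorname{conv}\{(0,0),(\ell,0),(d,y+d-\ell),(x+\ell,d),(z,z+d-\ell)\}$ with $\ell\in\{2,\ldots,d-2\}$, $x\in\{1,\ldots,d-\ell-1\}$, $y,z\in\{1,\ldots,\ell-1\}$; \item[(T4)] $\operatorname{conv}\{(0,0),(z'+\ell,z'),(d,y+d-\ell),(x+\ell,d),(z,z+d-\ell)\}$ with $\ell\in\{2,\ldots,d-2\}$, $y,z\in \{1,\ldots,\ell-1\}$, $x,z'\in\{1,\ldots,d-\ell-1\}$; \item[(T5)] $\operatorname{conv}\{(x_1,0),(z_2+\ell,z_2),(d,d-\ell+y_2),(x_2+\ell,d),(z_1,z_1+d-\ell),(0,y_1)\}$ with $\ell\in\{2,\ldots,d-2\}$, $x_1,y_2,z_1\in \{1,\ldots,\ell-1\}$, $x_2,y_1,z_2\in\{1,\ldots,d-\ell-1\}$. \end{enumerat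e}
   Context: A lattice polygon is the convex hull of finitely many points of $\mathbb{Z}^2$. A lattice direction is a non-zero primitive vector $v\in\mathbb{Z}^2$. The lattice width of a lattice polygon $\Delta$ in direction $v$ is $\operatorname{lw}_v(\Delta)=\max_{P\in\Delta}\langle P,v\rangle-\min_{P\in\Delta}\langle P,v\rangle$, and the lattice width is $\operatorname{lw}(\Delta)=\min_v\operatorname{lw}_v(\Delta)$ over all lattice directions $v$. Two lattice polygons $\Delta,\Delta'$ are (unimodularly) equivalent if there is a map $\varphi(x)=Ax+b$ with $A\in\mathrm{GL}_2(\mathbb{Z})$, $b\in\mathbb{Z}^2$, such that $\varphi(\Delta)=\Delta'$. A lattice polygon $\Delta$ is called minimal if $\operatorname{lw}(\Delta')<\operatorname{lw}(\Delta)$ for every lattice polygon $\Delta'\subsetneq\Delta$. -}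

module Defs where

open import Data.Nat as ℕ using (ℕ)
import Data.Nat.GCD as NG
open import Data.Integer using (ℤ; +_; -_; _+_; _-_; _*_; _≤_; _<_; _⊔_; _⊓_; ∣_∣)
open import Data.Product using (Σ; ∃; _×_; _,_)
open import Data.Sum using (_⊎_)
open import Data.List using (List; []; _∷_; map; length; foldr)
import Data.Nat.ListAction as L
open import Data.List.Relation.Unary.All using (All)
open import Data.List.Relation.Unary.Any using (Any)
open import Relation.Nullary using (¬_)
open import Relation.Binary.PropositionalEquality using (_≡_)

-- Points of ℤ².  A lattice polygon is given by a finite list of lattice
-- points S; the polygon itself is conv(S) ⊂ ℝ².
Point : Set
Point = ℤ × ℤ

_⊕_ : Point → Point → Point
(a , b) ⊕ (c , d) = (a + c , b + d)

scale : ℕ → Point → Point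
scale n (a , b) = ((+ n) * a , (+ n) * b)

origin : Point
origin = (+ 0 , + 0)

wsum : List ℕ → List Point → Point
wsum (w ∷ ws) (s ∷ ss) = scale w s ⊕ wsum ws ss
wsum _ _ = origin

-- A (rational) point p/1 lies in conv(S) iff it is a convex combination
-- with non-negative rational weights, i.e. (after clearing denominators)
-- N·p = Σ wᵢ sᵢ with wᵢ ∈ ℕ, N = Σ wᵢ > 0.
InHull : List Point → Point → Set
InHull S p = Σ (List ℕ) λ w →
  (length w ≡ length S) × (0 ℕ.< L.sum w) × (scale (L.sum w) p ≡ wsum w S)

_⊆H_ : List Point → List Point → Set
S' ⊆H S = All (InHull S) S'

_⊊H_ : List Point → List Point → Set
S' ⊊H S = (S' ⊆H S) × Any (λ p → ¬ InHull S' p) S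

SameHull : List Point → List Point → Set
SameHull S T = (S ⊆H T) × (T ⊆H S)

⟪_,_⟫ : Point → Point → ℤ
⟪ (a , b) , (c , d) ⟫ = a * c + b * d

-- lattice direction: non-zero primitive vector (gcd = 1 forces non-zero)
Primitive : Point → Set
Primitive (a , b) = NG.gcd ∣ a ∣ ∣ b ∣ ≡ 1

maxL minL : List ℤ → ℤ
maxL [] = + 0
maxL (x ∷ xs) = foldr _⊔_ x xs
minL [] = + 0
minL (x ∷ xs) = foldr _⊓_ x xs

-- lw_v(conv S) = max_{P ∈ conv S}⟨P,v⟩ − min_{P ∈ conv S}⟨P,v⟩; extrema of a
-- linear functional over conv S are attained at points of S.
lwDir : Point → List Point → ℤ
lwDir v S = maxL (map (λ p → ⟪ p , v ⟫) S) - minL (map (λ p → ⟪ p , v ⟫) S)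

IsLw : List Point → ℤ → Set
IsLw S d = (∃ λ v → Primitive v × (lwDir v S ≡ d))
         × (∀ v → Primitive v → d ≤ lwDir v S)

Minimal : List Point → Set
Minimal S = ∀ (S' : List Point) → ¬ (S' ≡ []) → S' ⊊H S →
            ∀ d d' → IsLw S d → IsLw S' d' → d' < d

record Affine : Set where
  constructor affine
  field
    a₁₁ a₁₂ a₂₁ a₂₂ t₁ t₂ : ℤ

open Affine public

Unimodular : Affine → Set
Unimodular φ = (a₁₁ φ * a₂₂ φ - a₁₂ φ * a₂₁ φ ≡ + 1)
             ⊎ (a₁₁ φ * a₂₂ φ - a₁₂ φ * a₂₁ φ ≡ - (+ 1))

apply : Affine → Point → Point
apply φ (x , y) = (a₁₁ φ * x + a₁₂ φ * y + t₁ φ , a₂₁ φ * x + a₂₂ φ * y + t₂ φ)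

-- φ(conv S) = conv(φ S) = conv T
Equivalent : List Point → List Point → Set
Equivalent S T = ∃ λ φ → Unimodular φ × SameHull (map (apply φ) S) T

In : ℤ → ℤ → ℤ → Set
In lo hi x = (lo ≤ x) × (x ≤ hi)

z0 z1 z2 : ℤ
z0 = + 0
z1 = + 1
z2 = + 2

T1 : ℤ → ℤ → ℤ → List Point
T1 d x y = (z0 , z0) ∷ (d , y) ∷ (x , d) ∷ []

T2 : ℤ → ℤ → ℤ → ℤ → ℤ → List Point
T2 d x₁ x₂ y₁ y₂ = (x₁ , z0) ∷ (d , y₂) ∷ (x₂ , d) ∷ (z0 , y₁) ∷ []

T3 : ℤ → ℤ → ℤ → ℤ → ℤ → List Point
T3 d ℓ x y z = (z0 , z0) ∷ (ℓ , z0) ∷ (d , y + d - ℓ) ∷ (x + ℓ , d)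
             ∷ (z , z + d - ℓ) ∷ []

T4 : ℤ → ℤ → ℤ → ℤ → ℤ → ℤ → List Point
T4 d ℓ x y z z' = (z0 , z0) ∷ (z' + ℓ , z') ∷ (d , y + d - ℓ) ∷ (x + ℓ , d)
                ∷ (z , z + d - ℓ) ∷ []

T5 : ℤ → ℤ → ℤ → ℤ → ℤ → ℤ → ℤ → ℤ → List Point
T5 d ℓ x₁ x₂ y₁ y₂ z₁ z₂ =
  (x₁ , z0) ∷ (z₂ + ℓ , z₂) ∷ (d , d - ℓ + y₂) ∷ (x₂ + ℓ , d)
  ∷ (z₁ , z₁ + d - ℓ) ∷ (z0 , y₁) ∷ []

OfForm : ℤ → List Point → Set
OfForm d T =
    (∃ λ x → ∃ λ y → In z0 d x × In z0 d y × (x + y ≤ d) × (T ≡ T1 d x y))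
  ⊎ (∃ λ x₁ → ∃ λ x₂ → ∃ λ y₁ → ∃ λ y₂ →
       In z1 (d - z1) x₁ × In z1 (d - z1) x₂ × In z1 (d - z1) y₁ × In z1 (d - z1) y₂
       × (x₁ ⊓ y₁ ≤ x₂ ⊔ y₂) × ((d - x₁) ⊓ y₂ ≤ (d - x₂) ⊔ y₁)
       × (T ≡ T2 d x₁ x₂ y₁ y₂))
  ⊎ (∃ λ ℓ → ∃ λ x → ∃ λ y → ∃ λ z →
       In z2 (d - z2) ℓ × In z1 (d - ℓ - z1) x × In z1 (ℓ - z1) y × In z1 (ℓ - z1) z
       × (T ≡ T3 d ℓ x y z))
  ⊎ (∃ λ ℓ → ∃ λ x → ∃ λ y → ∃ λ z → ∃ λ z' →
       In z2 (d - z2) ℓ × In z1 (ℓ - z1) y × In z1 (ℓ - z1) z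
       × In z1 (d - ℓ - z1) x × In z1 (d - ℓ - z1) z'
       × (T ≡ T4 d ℓ x y z z'))
  ⊎ (∃ λ ℓ → ∃ λ x₁ → ∃ λ x₂ → ∃ λ y₁ → ∃ λ y₂ → ∃ λ z₁ → ∃ λ z₂ →
       In z2 (d - z2) ℓ
       × In z1 (ℓ - z1) x₁ × In z1 (ℓ - z1) y₂ × In z1 (ℓ - z1) z₁
       × In z1 (d - ℓ - z1) x₂ × In z1 (d - ℓ - z1) y₁ × In z1 (d - ℓ - z1) z₂
       × (T ≡ T5 d ℓ x₁ x₂ y₁ y₂ z₁ z₂))

module Submission where

-- Every lattice polygon of lattice width d contains, up to unimodular equivalence, a polygon T of
-- one of the forms (T1)–(T5) all of whose widths are at least d; minimality then forces T to be
-- the whole polygon.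
--
-- To find T, let x be a direction realising the width, with leftmost point (0,0) and rightmost
-- point (d,q), where 0 ≤ q < d after a shear.  These two points alone give width at least d in all
-- directions (k,1) except (0,1) and (−1,1).  The columns between the chord and the extreme points
-- for y and y − x consist of points of the polygon, so moving those points along their columns
-- shrinks the widths for y and y − x until one of them is exactly d and the other at least d.
-- Say it is the one for y.  Then four points lie on the sides of a square [0,d]², and either they
-- already have width d along both diagonals, giving (T1) or (T2), or the width for y − x can be
-- shrunk to d as well.  In the latter case six points lie on the sides of a hexagon
-- bounded by level lines of x, y and x − y, and which of its vertices are among them decides
-- between (T3), (T4), (T5) and the previous case in another basis.

open import Defs
open import Data.Nat as ℕ using (ℕ; suc; z≤n; s≤s)
import Data.Nat.Divisibility as ℕ
import Data.Nat.GCD as ℕ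
import Data.Nat.ListAction as L
import Data.Nat.Properties as ℕ
open import Data.Nat.Solver using (module +-*-Solver)
open +-*-Solver using (_:+_; _:*_; _:=_) renaming (solve to nsolve)
open import Data.Integer using (ℤ; +_; -[1+_]; -_; _+_; _-_; _*_; _≤_; _<_; _⊔_; _⊓_; ∣_∣; +≤+; +<+)
import Data.Integer.Divisibility.Signed as ℤ
open import Data.Integer.DivMod using (_/ℕ_; _%ℕ_; n%ℕd<d; a≡a%ℕn+[a/ℕn]*n)
open import Data.Integer.Properties
open import Data.Integer.Tactic.RingSolver using (solve; solve-∀)
open import Data.Empty using (⊥; ⊥-elim)
open import Data.List using (List; []; _∷_; map; length; foldr)
-- Aliases, because the ring solver cannot resolve the overloading of _∷_ with that of All.
open import Data.List using () renaming (_∷_ to _⨾_; [] to ∅)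
open import Data.List.Membership.Propositional using (_∈_)
open import Data.List.Membership.Propositional.Properties using (∈-map⁻; ∈-map⁺)
open import Data.List.Properties using (length-map; map-∘; map-id; map-cong)
open import Data.List.Relation.Unary.All as All using (All; []; _∷_)
import Data.List.Relation.Unary.All.Properties as All
open import Data.List.Relation.Unary.Any as Any using (Any; here; there)
open import Data.Product using (Σ; ∃; _×_; _,_; proj₁; proj₂)
open import Data.Sum as Sum using (_⊎_; inj₁; inj₂; [_,_]′)
open import Function using (_∘_)
open import Relation.Nullary using (¬_; Dec; yes; no; contradiction)
open import Relation.Nullary.Decidable using (_⊎-dec_)
open import Relation.Binary.PropositionalEquality using (_≡_; refl; sym; trans; cong; cong₂; subst; subst₂)

-- Minimality speaks only of subpolygons that leave some point outside their hull, so forcing T to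
-- be the whole polygon requires hull membership to be decidable. This is why a planar separation
-- theorem precedes the geometry of widths. The points that are extreme upwards, for y and for y -
-- x, are lowered by a common s, and those extreme downwards are raised by a common t. Both widths
-- then fall by the same s + t, so the smaller one reaches d while the other is still at least d,
-- and the extreme points keep their relative order. The integers s and, later, the side length ℓ of
-- the hexagon only have to lie above three bounds and below three others, which comes to nine
-- inequalities. For ℓ, four of them are exactly what the failure of width d along y - x on the
-- quadrilateral provides; hence quadrilateral and hexagon exhaust the possibilities. A unimodular
-- map of order six turns the hexagon and exchanges ℓ with d - ℓ, so each configuration of marked
-- vertices is treated in one position only.

infixl 5 _⊞_
_⊞_ : ∀ {a b c d} → a ≤ b → c ≤ d → a + c ≤ b + d
_⊞_ = +-mono-≤

-- Abstract, so that the ring solver's proof terms are never unfolded.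
abstract
  lin : ∀ {a b c d} → c ≤ d → b - a ≡ d - c → a ≤ b
  lin h e = 0≤i-j⇒j≤i (subst (+ 0 ≤_) (sym e) (i≤j⇒0≤j-i h))

0≤[_] : ∀ n → + 0 ≤ + n
0≤[ n ] = +≤+ z≤n

-- Nonlinear inequalities are certified by adding products of slacks to the left of `lin`; what
-- remains is a ring identity.
mul : ∀ {a b c d} → a ≤ b → c ≤ d → + 0 ≤ (b - a) * (d - c)
mul {a} {b} {c} {d} h k with b - a | d - c | i≤j⇒0≤j-i h | i≤j⇒0≤j-i k
... | + m | + n | +≤+ _ | +≤+ _ = subst (+ 0 ≤_) (pos-* m n) (+≤+ z≤n)

-- Strictness is written `z1 + y ≤ x`, a form that `lin` can consume.
split : ∀ x y → x ≤ y ⊎ z1 + y ≤ x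
split x y with x ≤? y
... | yes p = inj₁ p
... | no ¬p = inj₂ (i<j⇒suc[i]≤j (≰⇒> ¬p))

1≰0 : ¬ (z1 ≤ + 0)
1≰0 (+≤+ ())

-- Convex hulls

-- Unlike in `InHull`, the total weight is not tied to the target, so combinations can be added and
-- scaled freely.
Comb : List Point → ℕ → Point → Set
Comb S N P = Σ (List ℕ) λ w → (length w ≡ length S) × (L.sum w ≡ N) × (wsum w S ≡ P)

comb-zero : ∀ S → Comb S 0 origin
comb-zero [] = [] , refl , refl , refl
comb-zero ((a , b) ∷ S) with comb-zero S
... | w , l , s , e = 0 ∷ w , cong suc l , s , cong (scale 0 (a , b) ⊕_) e

comb-add : ∀ {S N M P Q} → Comb S N P → Comb S M Q → Comb S (N ℕ.+ M) (P ⊕ Q)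
comb-add {[]} ([] , _ , refl , refl) ([] , _ , refl , refl) = [] , refl , refl , refl
comb-add {(a , b) ∷ S} (m ∷ w , l , refl , refl) (n ∷ u , k , refl , refl)
  with comb-add {S} (w , ℕ.suc-injective l , refl , refl) (u , ℕ.suc-injective k , refl , refl)
... | v , l′ , s , e =
  m ℕ.+ n ∷ v , cong suc l′
  , trans (cong (m ℕ.+ n ℕ.+_) s) (interchange m n _ _)
  , trans (cong (scale (m ℕ.+ n) (a , b) ⊕_) e)
      (cong₂ _,_ (dist (+ m) (+ n) a _ _) (dist (+ m) (+ n) b _ _))
  where
  interchange : ∀ m n x y → m ℕ.+ n ℕ.+ (x ℕ.+ y) ≡ m ℕ.+ x ℕ.+ (n ℕ.+ y)
  interchange = nsolve 4 (λ m n x y → m :+ n :+ (x :+ y) := m :+ x :+ (n :+ y)) refl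
  dist : ∀ m n a x y → (m + n) * a + (x + y) ≡ m * a + x + (n * a + y)
  dist = solve-∀

comb-scale : ∀ {S N P} k → Comb S N P → Comb S (k ℕ.* N) (scale k P)
comb-scale {[]} k ([] , _ , refl , refl) =
  [] , refl , sym (ℕ.*-zeroʳ k) , cong₂ _,_ (sym (*-zeroʳ (+ k))) (sym (*-zeroʳ (+ k)))
comb-scale {(a , b) ∷ S} k (n ∷ w , l , refl , refl) with comb-scale {S} k (w , ℕ.suc-injective l , refl , refl)
... | v , l′ , s , e =
  k ℕ.* n ∷ v , cong suc l′
  , trans (cong (k ℕ.* n ℕ.+_) s) (sym (ℕ.*-distribˡ-+ k n _))
  , trans (cong (scale (k ℕ.* n) (a , b) ⊕_) e) (cong₂ _,_ (dist a _) (dist b _))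
  where
  dist : ∀ a x → + (k ℕ.* n) * a + + k * x ≡ + k * (+ n * a + x)
  dist a x = trans (cong (λ c → c * a + + k * x) (pos-* k n))
                   (trans (cong (_+ + k * x) (*-assoc (+ k) (+ n) a)) (sym (*-distribˡ-+ (+ k) (+ n * a) x)))

comb-member : ∀ {S s} → s ∈ S → Comb S 1 s
comb-member {(a , b) ∷ S} (here refl) with comb-zero S
... | w , l , s , e = 1 ∷ w , cong suc l , cong suc s ,
  trans (cong (scale 1 (a , b) ⊕_) e) (cong₂ _,_ (one a) (one b))
  where
  one : ∀ a → + 1 * a + + 0 ≡ a
  one = solve-∀
comb-member {(a , b) ∷ S} (there i) with comb-member i
... | w , l , s , e = 0 ∷ w , cong suc l , s ,
  trans (cong (scale 0 (a , b) ⊕_) e) (cong₂ _,_ (+-identityˡ _) (+-identityˡ _))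

hull⇒comb : ∀ {S p} → InHull S p → ∃ λ N → (0 ℕ.< N) × Comb S N (scale N p)
hull⇒comb (w , l , 0<N , e) = L.sum w , 0<N , w , l , refl , sym e

comb⇒hull : ∀ {S p N} → 0 ℕ.< N → Comb S N (scale N p) → InHull S p
comb⇒hull 0<N (w , l , refl , e) = w , l , 0<N , sym e

scale-1 : ∀ p → scale 1 p ≡ p
scale-1 (a , b) = cong₂ _,_ (*-identityˡ a) (*-identityˡ b)

scale-scale : ∀ m n p → scale m (scale n p) ≡ scale (m ℕ.* n) p
scale-scale m n (a , b) = cong₂ _,_ (lem a) (lem b)
  where
  lem : ∀ a → + m * (+ n * a) ≡ + (m ℕ.* n) * a
  lem a = trans (sym (*-assoc (+ m) (+ n) a)) (cong (_* a) (sym (pos-* m n)))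

scale-⊕ : ∀ m p q → scale m (p ⊕ q) ≡ scale m p ⊕ scale m q
scale-⊕ m (a , b) (c , d) = cong₂ _,_ (*-distribˡ-+ (+ m) a c) (*-distribˡ-+ (+ m) b d)

∈⇒hull : ∀ {S s} → s ∈ S → InHull S s
∈⇒hull {S} {s} i = comb⇒hull (s≤s z≤n) (subst (Comb S 1) (sym (scale-1 s)) (comb-member i))

-- The points of T are combinations of S with different total weights; M is a common denominator,
-- the product of these totals.
comb-trans : ∀ {S T} → T ⊆H S → ∀ w → length w ≡ length T →
  ∃ λ M → (0 ℕ.< M) × Comb S (M ℕ.* L.sum w) (scale M (wsum w T))
comb-trans {S} [] [] l = 1 , s≤s z≤n , comb-zero S
comb-trans {S} {t ∷ T} (h ∷ hs) (n ∷ w) l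
  with hull⇒comb h | comb-trans hs w (ℕ.suc-injective l)
... | N , 0<N , c | M , 0<M , c′ =
  M ℕ.* N , ℕ.*-mono-≤ 0<M 0<N ,
  subst₂ (Comb S) weight value (comb-add (comb-scale (M ℕ.* n) c) (comb-scale N c′))
  where
  swapN : M ℕ.* n ℕ.* N ≡ M ℕ.* N ℕ.* n
  swapN = nsolve 3 (λ M n N → M :* n :* N := M :* N :* n) refl M n N
  weight : M ℕ.* n ℕ.* N ℕ.+ N ℕ.* (M ℕ.* L.sum w) ≡ M ℕ.* N ℕ.* (n ℕ.+ L.sum w)
  weight = nsolve 4 (λ M n N s → M :* n :* N :+ N :* (M :* s) := M :* N :* (n :+ s)) refl M n N (L.sum w)
  value : scale (M ℕ.* n) (scale N t) ⊕ scale N (scale M (wsum w T))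
        ≡ scale (M ℕ.* N) (scale n t ⊕ wsum w T)
  value = trans
    (cong₂ _⊕_ (trans (scale-scale (M ℕ.* n) N t) (trans (cong (λ k → scale k t) swapN) (sym (scale-scale (M ℕ.* N) n t))))
               (trans (scale-scale N M _) (cong (λ k → scale k (wsum w T)) (ℕ.*-comm N M))))
    (sym (scale-⊕ (M ℕ.* N) (scale n t) (wsum w T)))

hull-trans : ∀ {S T p} → T ⊆H S → InHull T p → InHull S p
hull-trans {S} {T} {p} h (w , l , 0<N , e) with comb-trans h w l
... | M , 0<M , c = comb⇒hull (ℕ.*-mono-≤ 0<M 0<N)
  (subst (Comb S (M ℕ.* L.sum w)) (trans (cong (scale M) (sym e)) (scale-scale M (L.sum w) p)) c)

⊆H-trans : ∀ {R S T} → R ⊆H S → S ⊆H T → R ⊆H T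
⊆H-trans h k = All.map (hull-trans k) h

⊆⇒⊆H : ∀ {S T} → All (_∈ T) S → S ⊆H T
⊆⇒⊆H = All.map ∈⇒hull

⊆H-refl : ∀ {S} → S ⊆H S
⊆H-refl = All.tabulate ∈⇒hull

-- Weights are integers with sign conditions instead of naturals, so that callers can use
-- differences and determinants and leave the rest to ring identities.
hull₃ : ∀ {S p q r} u v w x y → InHull S p → InHull S q → InHull S r →
  + 0 ≤ u → + 0 ≤ v → + 0 ≤ w → z1 ≤ u + v + w →
  (u + v + w) * x ≡ u * proj₁ p + v * proj₁ q + w * proj₁ r →
  (u + v + w) * y ≡ u * proj₂ p + v * proj₂ q + w * proj₂ r →
  InHull S (x , y)
hull₃ {S} {p} {q} {r} (+ u) (+ v) (+ w) x y hp hq hr _ _ _ 0<N ex ey =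
  hull-trans (hp ∷ hq ∷ hr ∷ []) (u ∷ v ∷ w ∷ [] , refl , subst (1 ℕ.≤_) total (drop‿+≤+ 0<N) ,
    cong₂ _,_ (eq ex) (eq ey))
  where
  total : u ℕ.+ v ℕ.+ w ≡ u ℕ.+ (v ℕ.+ (w ℕ.+ 0))
  total = trans (ℕ.+-assoc u v w) (cong (λ k → u ℕ.+ (v ℕ.+ k)) (sym (ℕ.+-identityʳ w)))
  eq : ∀ {x a b c} → + (u ℕ.+ v ℕ.+ w) * x ≡ + u * a + + v * b + + w * c →
    + (u ℕ.+ (v ℕ.+ (w ℕ.+ 0))) * x ≡ + u * a + (+ v * b + (+ w * c + + 0))
  eq {x} {a} {b} {c} e = trans (cong (λ n → + n * x) (sym total)) (trans e (reassoc (+ u * a) (+ v * b) (+ w * c)))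
    where
    reassoc : ∀ a b c → a + b + c ≡ a + (b + (c + + 0))
    reassoc = solve-∀

hull₂ : ∀ {S p q} u v x y → InHull S p → InHull S q →
  + 0 ≤ u → + 0 ≤ v → z1 ≤ u + v →
  (u + v) * x ≡ u * proj₁ p + v * proj₁ q →
  (u + v) * y ≡ u * proj₂ p + v * proj₂ q →
  InHull S (x , y)
hull₂ {S} {p} {q} u v x y hp hq hu hv 0<N ex ey =
  hull₃ u v (+ 0) x y hp hq hq hu hv 0≤[ 0 ] (subst (z1 ≤_) (sym (+-identityʳ _)) 0<N)
   (eq ex) (eq ey)
  where
  eq : ∀ {x a b} → (u + v) * x ≡ u * a + v * b → (u + v + + 0) * x ≡ u * a + v * b + + 0 * b
  eq {x} e = trans (cong (_* x) (+-identityʳ (u + v))) (trans e (sym (+-identityʳ _)))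

-- Affine maps

wsum-map : ∀ φ w S → length w ≡ length S →
  wsum w (map (apply φ) S) ≡
  ( a₁₁ φ * proj₁ (wsum w S) + a₁₂ φ * proj₂ (wsum w S) + + L.sum w * t₁ φ
  , a₂₁ φ * proj₁ (wsum w S) + a₂₂ φ * proj₂ (wsum w S) + + L.sum w * t₂ φ )
wsum-map φ [] [] l = cong₂ _,_ (lem (a₁₁ φ) (a₁₂ φ) (t₁ φ)) (lem (a₂₁ φ) (a₂₂ φ) (t₂ φ))
  where
  lem : ∀ a b t → + 0 ≡ a * + 0 + b * + 0 + + 0 * t
  lem = solve-∀
wsum-map φ (n ∷ w) ((a , b) ∷ S) l with wsum w (map (apply φ) S) | wsum-map φ w S (ℕ.suc-injective l)
... | _ | refl = cong₂ _,_ (lem (a₁₁ φ) (a₁₂ φ) (t₁ φ) (+ n) (+ L.sum w) _ _ a b)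
                           (lem (a₂₁ φ) (a₂₂ φ) (t₂ φ) (+ n) (+ L.sum w) _ _ a b)
  where
  lem : ∀ r s t n m x y a b → n * (r * a + s * b + t) + (r * x + s * y + m * t) ≡ r * (n * a + x) + s * (n * b + y) + (n + m) * t
  lem = solve-∀

hull-map : ∀ φ {S p} → InHull S p → InHull (map (apply φ) S) (apply φ p)
hull-map φ {S} {a , b} (w , l , 0<N , e) = w , trans l (sym (length-map _ S)) , 0<N ,
  trans (cong₂ _,_ (lem (a₁₁ φ) (a₁₂ φ) (t₁ φ)) (lem (a₂₁ φ) (a₂₂ φ) (t₂ φ))) (sym (wsum-map φ w S l))
  where
  dist : ∀ n r s t a b → n * (r * a + s * b + t) ≡ r * (n * a) + s * (n * b) + n * t
  dist = solve-∀
  lem : ∀ r s t → + L.sum w * (r * a + s * b + t) ≡ r * proj₁ (wsum w S) + s * proj₂ (wsum w S) + + L.sum w * t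
  lem r s t = trans (dist (+ L.sum w) r s t a b)
    (cong₂ (λ x y → r * x + s * y + + L.sum w * t) (cong proj₁ e) (cong proj₂ e))

⊆H-map : ∀ φ {S T} → S ⊆H T → map (apply φ) S ⊆H map (apply φ) T
⊆H-map φ [] = []
⊆H-map φ (h ∷ hs) = hull-map φ h ∷ ⊆H-map φ hs

-- Separation of a point from a convex hull

det : Point → Point → ℤ
det (a , b) (c , d) = a * d - b * c

wsum-bound : ∀ {v k} w {T} → All (λ t → k ≤ ⟪ t , v ⟫) T → length w ≡ length T →
  + L.sum w * k ≤ ⟪ wsum w T , v ⟫
wsum-bound {_ , _} [] [] _ = ≤-refl
wsum-bound {c , d} {k} (n ∷ w) {(a , b) ∷ T} (h ∷ hs) l =
  ≤-trans (≤-trans (≤-reflexive (trans (cong (_* k) (pos-+ n (L.sum w))) (*-distribʳ-+ k (+ n) (+ L.sum w))))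
            (+-mono-≤ (*-monoˡ-≤-nonNeg (+ n) h) (wsum-bound w hs (ℕ.suc-injective l))))
    (≤-reflexive (dist (+ n) a b c d _ _))
  where
  dist : ∀ n a b c d x y → n * (a * c + b * d) + (x * c + y * d) ≡ (n * a + x) * c + (n * b + y) * d
  dist = solve-∀

hull-bound : ∀ {v k T p} → All (λ t → k ≤ ⟪ t , v ⟫) T → InHull T p → k ≤ ⟪ p , v ⟫
hull-bound {c , d} {k} {T} {a , b} h (w , l , 0<N , e) with L.sum w | wsum-bound w h l | 0<N | e
... | suc n | bound | _ | e′ = *-cancelˡ-≤-pos k _ (+ suc n)
  (≤-trans bound (≤-reflexive (trans (cong (⟪_, c , d ⟫) (sym e′)) (factor (+ suc n) a b c d))))
  where
  factor : ∀ n a b c d → n * a * c + n * b * d ≡ n * (a * c + b * d)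
  factor = solve-∀

-- To be used with `f = det t`: the position of T relative to the line through the origin and t.
data Signs (f : Point → ℤ) (T : List Point) : Set where
  vanishes : ∀ {s} → s ∈ T → f s ≡ + 0 → Signs f T
  mixed    : ∀ {s s′} → s ∈ T → z1 ≤ f s → s′ ∈ T → z1 ≤ - f s′ → Signs f T
  allPos   : All (λ s → z1 ≤ f s) T → Signs f T
  allNeg   : All (λ s → z1 ≤ - f s) T → Signs f T

signOf : ∀ x → x ≡ + 0 ⊎ z1 ≤ x ⊎ z1 ≤ - x
signOf (+ 0)     = inj₁ refl
signOf (+ suc n) = inj₂ (inj₁ (+≤+ (s≤s z≤n)))
signOf -[1+ n ]  = inj₂ (inj₂ (+≤+ (s≤s z≤n)))

signs : ∀ f T → Signs f T
signs f [] = allPos []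
signs f (s ∷ T) with signOf (f s) | signs f T
... | inj₁ e        | _                = vanishes (here refl) e
... | _             | vanishes i e     = vanishes (there i) e
... | _             | mixed i p j q    = mixed (there i) p (there j) q
... | inj₂ (inj₁ p) | allPos ps        = allPos (p ∷ ps)
... | inj₂ (inj₂ q) | allNeg qs        = allNeg (q ∷ qs)
... | inj₂ (inj₁ p) | allNeg []        = allPos (p ∷ [])
... | inj₂ (inj₁ p) | allNeg (q ∷ qs)  = mixed (here refl) p (there (here refl)) q
... | inj₂ (inj₂ q) | allPos []        = allNeg (q ∷ [])
... | inj₂ (inj₂ q) | allPos (p ∷ ps)  = mixed (there (here refl)) p (here refl) q

0≤i+∣i∣ : ∀ i → + 0 ≤ i + + ∣ i ∣
0≤i+∣i∣ (+ n)    = +≤+ z≤n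
0≤i+∣i∣ -[1+ n ] = ≤-reflexive (sym (+-inverseˡ (+ suc n)))

-- Where g is at least 1, any M ≥ 1 + |f s| suffices at s; M is the sum of these bounds over T.
dominate : ∀ (f g : Point → ℤ) {T} → All (λ s → z1 ≤ g s) T →
  ∃ λ M → (+ 0 ≤ M) × All (λ s → z1 ≤ f s + M * g s) T
dominate f g [] = + 0 , ≤-refl , []
dominate f g {s ∷ T} (p ∷ ps) with dominate f g ps
... | M , 0≤M , hs = M + (z1 + + ∣ f s ∣) , lin (0≤M ⊞ 0≤[ suc ∣ f s ∣ ]) (pad M (+ ∣ f s ∣))
  , first (f s) M (+ ∣ f s ∣) (g s) 0≤M 0≤[ ∣ f s ∣ ] (0≤i+∣i∣ (f s)) p
  ∷ All.zipWith (λ {x} (h , k) → rest (f x) M (+ ∣ f s ∣) (g x) 0≤[ ∣ f s ∣ ] h k) (hs , ps)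
  where
  pad : ∀ M a → M + (z1 + a) - + 0 ≡ M + (z1 + a) - (+ 0 + + 0)
  pad = solve-∀
  first : ∀ x M a y → + 0 ≤ M → + 0 ≤ a → + 0 ≤ x + a → z1 ≤ y → z1 ≤ x + (M + (z1 + a)) * y
  first x M a y h1 h2 h3 h4 = lin (mul h1 h4 ⊞ mul h2 h4 ⊞ h3 ⊞ h4 ⊞ h1) (solve (x ⨾ M ⨾ a ⨾ y ⨾ ∅))
  rest : ∀ x M a y → + 0 ≤ a → z1 ≤ x + M * y → z1 ≤ y → z1 ≤ x + (M + (z1 + a)) * y
  rest x M a y h1 h2 h3 = lin (mul h1 h3 ⊞ h2 ⊞ h3 ⊞ h1 ⊞ 0≤[ 1 ]) (solve (x ⨾ M ⨾ a ⨾ y ⨾ ∅))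

-- On a common line ⟨s,v⟩ t = ⟨t,v⟩ s. The shape is the one `hull₂` asks for when its target is the
-- origin.
parallel : ∀ t v s → det t s ≡ + 0 →
    ((⟪ s , v ⟫ + - ⟪ t , v ⟫) * + 0 ≡ ⟪ s , v ⟫ * proj₁ t + - ⟪ t , v ⟫ * proj₁ s)
  × ((⟪ s , v ⟫ + - ⟪ t , v ⟫) * + 0 ≡ ⟪ s , v ⟫ * proj₂ t + - ⟪ t , v ⟫ * proj₂ s)
parallel (a , b) (c , d) (x , y) e = ring refl refl refl e
  where
  -- The pairings enter through equations because comparing them with their unfoldings inside
  -- larger products makes the conversion checker diverge in practice.
  ring : ∀ {σ τ k} → σ ≡ x * c + y * d → τ ≡ a * c + b * d → k ≡ a * y - b * x → k ≡ + 0 →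
    ((σ + - τ) * + 0 ≡ σ * a + - τ * x) × ((σ + - τ) * + 0 ≡ σ * b + - τ * y)
  ring refl refl refl e =
    eq (x * c + y * d + - (a * c + b * d)) d (solve (a ⨾ b ⨾ c ⨾ d ⨾ x ⨾ y ⨾ ∅)) ,
    eq (x * c + y * d + - (a * c + b * d)) (- c) (solve (a ⨾ b ⨾ c ⨾ d ⨾ x ⨾ y ⨾ ∅))
    where
    eq : ∀ n {m} k → m ≡ k * (a * y - b * x) → n * + 0 ≡ m
    eq n k r = trans (*-zeroʳ n) (sym (trans r (trans (cong (k *_) e) (*-zeroʳ k))))

triangle-absurd : ∀ {D τ σ σ′ m k} → D * τ + m * σ + k * σ′ ≡ + 0 → z1 + D ≤ + 0 → z1 + τ ≤ z1 →
  z1 ≤ m → z1 ≤ σ → z1 ≤ k → z1 ≤ σ′ → z1 ≤ + 0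
triangle-absurd {D} {τ} {σ} {σ′} {m} {k} e n h₁ h₂ h₃ h₄ h₅ =
  lin {z1} {+ 0} (≤-reflexive e ⊞ mul n h₁ ⊞ mul h₂ h₃ ⊞ mul h₄ h₅ ⊞ h₁ ⊞ h₂ ⊞ h₃ ⊞ h₄ ⊞ h₅ ⊞ 0≤[ 1 ])
    (solve (D ⨾ τ ⨾ σ ⨾ σ′ ⨾ m ⨾ k ⨾ ∅))

-- If D were negative, the first term would be non-negative and the other two positive.
triangle : ∀ {D τ σ σ′ m k} → D * τ + m * σ + k * σ′ ≡ + 0 → z1 + τ ≤ z1 →
  z1 ≤ m → z1 ≤ σ → z1 ≤ k → z1 ≤ σ′ → + 0 ≤ D
triangle {D} {τ} {σ} {σ′} {m} {k} e h₁ h₂ h₃ h₄ h₅ with split (+ 0) D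
... | inj₁ p = p
... | inj₂ n = contradiction (triangle-absurd {D} {τ} {σ} {σ′} {m} {k} e n h₁ h₂ h₃ h₄ h₅) 1≰0

0≤i*i : ∀ i → + 0 ≤ i * i
0≤i*i (+ 0) = +≤+ z≤n
0≤i*i (+ suc n) = +≤+ z≤n
0≤i*i -[1+ n ] = +≤+ z≤n

norm-pos : ∀ p → p ≡ origin ⊎ z1 ≤ ⟪ p , p ⟫
norm-pos (+ 0 , + 0)       = inj₁ refl
norm-pos (+ 0 , + suc n)   = inj₂ (+≤+ (s≤s z≤n))
norm-pos (+ 0 , -[1+ n ])  = inj₂ (+≤+ (s≤s z≤n))
norm-pos (+ suc m , b)     = inj₂ (+-mono-≤ {z1} (+≤+ (s≤s z≤n)) (0≤i*i b))
norm-pos (-[1+ m ] , b)    = inj₂ (+-mono-≤ {z1} (+≤+ (s≤s z≤n)) (0≤i*i b))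

-- The linear relation among three plane vectors (Cramer's rule), paired with v; `cramer` is the
-- same relation by coordinates.
plücker : ∀ s s′ t v → det s s′ * ⟪ t , v ⟫ + - det t s′ * ⟪ s , v ⟫ + det t s * ⟪ s′ , v ⟫ ≡ + 0
plücker (x , y) (x′ , y′) (a , b) (c , d) = ring refl refl refl refl refl refl
  where
  ring : ∀ {D m k τ σ σ′} → D ≡ x * y′ - y * x′ → τ ≡ a * c + b * d → m ≡ a * y′ - b * x′ → σ ≡ x * c + y * d →
    k ≡ a * y - b * x → σ′ ≡ x′ * c + y′ * d → D * τ + - m * σ + k * σ′ ≡ + 0
  ring refl refl refl refl refl refl = solve (x ⨾ y ⨾ x′ ⨾ y′ ⨾ a ⨾ b ⨾ c ⨾ d ⨾ ∅)

cramer : ∀ s s′ t →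
    ((det s s′ + - det t s′ + det t s) * + 0 ≡ det s s′ * proj₁ t + - det t s′ * proj₁ s + det t s * proj₁ s′)
  × ((det s s′ + - det t s′ + det t s) * + 0 ≡ det s s′ * proj₂ t + - det t s′ * proj₂ s + det t s * proj₂ s′)
cramer (x , y) (x′ , y′) (a , b) = ring refl refl refl
  where
  ring : ∀ {D m k} → D ≡ x * y′ - y * x′ → m ≡ a * y′ - b * x′ → k ≡ a * y - b * x →
    ((D + - m + k) * + 0 ≡ D * a + - m * x + k * x′) × ((D + - m + k) * + 0 ≡ D * b + - m * y + k * y′)
  ring refl refl refl =
    solve (x ⨾ y ⨾ x′ ⨾ y′ ⨾ a ⨾ b ⨾ ∅) , solve (x ⨾ y ⨾ x′ ⨾ y′ ⨾ a ⨾ b ⨾ ∅)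

-- The functional ⟨ t , ·⟩ + M det(t , ·), represented by a vector.
tilt : Point → ℤ → Point
tilt (a , b) M = a - M * b , b + M * a

tilt-det : ∀ t M s → ⟪ t , s ⟫ + M * det t s ≡ ⟪ s , tilt t M ⟫
tilt-det (a , b) M (x , y) = ring refl refl refl
  where
  ring : ∀ {σ k u} → σ ≡ a * x + b * y → k ≡ a * y - b * x → u ≡ x * (a - M * b) + y * (b + M * a) → σ + M * k ≡ u
  ring refl refl refl = solve (a ⨾ b ⨾ M ⨾ x ⨾ y ⨾ ∅)

tilt-neg-det : ∀ t M s → ⟪ t , s ⟫ + M * - det t s ≡ ⟪ s , tilt t (- M) ⟫
tilt-neg-det (a , b) M (x , y) = ring refl refl refl
  where
  ring : ∀ {σ k u} → σ ≡ a * x + b * y → k ≡ a * y - b * x → u ≡ x * (a - - M * b) + y * (b + - M * a) → σ + M * - k ≡ u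
  ring refl refl refl = solve (a ⨾ b ⨾ M ⨾ x ⨾ y ⨾ ∅)

-- Since det(t,t) = 0, tilting by any M keeps the value ⟨t,t⟩ at t.
tilt-self : ∀ t M → ⟪ t , t ⟫ ≡ ⟪ t , tilt t M ⟫
tilt-self (a , b) M = ring refl refl
  where
  ring : ∀ {σ u} → σ ≡ a * a + b * b → u ≡ a * (a - M * b) + b * (b + M * a) → σ ≡ u
  ring refl refl = solve (a ⨾ b ⨾ M ⨾ ∅)

Separated : List Point → Set
Separated T = ∃ λ v → All (λ t → z1 ≤ ⟪ t , v ⟫) T

weights₂ : ∀ {σ τ} → z1 ≤ σ → z1 + τ ≤ z1 → (+ 0 ≤ σ) × (+ 0 ≤ - τ) × (z1 ≤ σ + - τ)
weights₂ {σ} {τ} p n = ≤-trans 0≤[ 1 ] p , lin n (solve (τ ⨾ ∅)) , lin (p ⊞ n) (solve (σ ⨾ τ ⨾ ∅))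

weights₃ : ∀ {D m k} → + 0 ≤ D → z1 ≤ m → z1 ≤ k → z1 ≤ D + m + k
weights₃ {D} {m} {k} hD hm hk = lin (hD ⊞ hm ⊞ hk ⊞ 0≤[ 1 ]) (solve (D ⨾ m ⨾ k ⨾ ∅))

-- When t lies on the wrong side of v, either the signs of det t on T put −t into the cone over T,
-- or a small perturbation of ± det t is positive on both T and t.
extend-separation : ∀ t T v → All (λ s → z1 ≤ ⟪ s , v ⟫) T → z1 + ⟪ t , v ⟫ ≤ z1 → z1 ≤ ⟪ t , t ⟫ →
  Signs (det t) T → InHull (t ∷ T) origin ⊎ Separated (t ∷ T)
extend-separation t T v pos n _ (vanishes {s} i e) =
  let h₁ , h₂ , h₃ = weights₂ (All.lookup pos i) n
      e₁ , e₂ = parallel t v s e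
  in inj₁ (hull₂ ⟪ s , v ⟫ (- ⟪ t , v ⟫) (+ 0) (+ 0) (∈⇒hull (here refl)) (∈⇒hull (there i)) h₁ h₂ h₃ e₁ e₂)
extend-separation t T v pos n _ (mixed {s} {s′} i p j q) =
  inj₁ (hull₃ (det s s′) (- det t s′) (det t s) (+ 0) (+ 0)
    (∈⇒hull (here refl)) (∈⇒hull (there i)) (∈⇒hull (there j))
    D≥0 (≤-trans 0≤[ 1 ] q) (≤-trans 0≤[ 1 ] p) (weights₃ D≥0 q p) (proj₁ (cramer s s′ t)) (proj₂ (cramer s s′ t)))
  where
  D≥0 : + 0 ≤ det s s′
  -- The two other weights are positive; pairing the relation with v, which is non-positive on t and
  -- positive on s and s′, fixes the sign of the third.
  D≥0 = triangle {det s s′} {⟪ t , v ⟫} {⟪ s , v ⟫} {⟪ s′ , v ⟫} { - det t s′} {det t s}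
    (plücker s s′ t v) n q (All.lookup pos i) p (All.lookup pos j)
extend-separation t T v pos _ l (allPos ps) =
  let M , _ , hs = dominate (λ s → ⟪ t , s ⟫) (det t) ps
  in inj₂ (_ , subst (z1 ≤_) (tilt-self t M) l ∷ All.map (λ {s} → subst (z1 ≤_) (tilt-det t M s)) hs)
extend-separation t T v pos _ l (allNeg ps) =
  let M , _ , hs = dominate (λ s → ⟪ t , s ⟫) (λ s → - det t s) ps
  in inj₂ (_ , subst (z1 ≤_) (tilt-self t (- M)) l ∷ All.map (λ {s} → subst (z1 ≤_) (tilt-neg-det t M s)) hs)

-- Gordan's alternative in the plane, proved by adding one point at a time.
separate-origin : ∀ T → InHull T origin ⊎ Separated T
separate-origin [] = inj₂ (origin , [])
separate-origin (t ∷ T) with separate-origin T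
... | inj₁ h = inj₁ (hull-trans (⊆⇒⊆H (All.tabulate there)) h)
... | inj₂ (v , pos) with split z1 ⟪ t , v ⟫ | norm-pos t
...   | inj₁ p | _         = inj₂ (v , p ∷ pos)
...   | inj₂ _ | inj₁ refl = inj₁ (∈⇒hull (here refl))
...   | inj₂ n | inj₂ l    = extend-separation t T v pos n l (signs (det t) T)

map-inverse : ∀ {f g : Point → Point} → (∀ p → g (f p) ≡ p) → ∀ S → map g (map f S) ≡ S
map-inverse h S = trans (sym (map-∘ S)) (trans (map-cong h S) (map-id S))

translate : Point → Affine
translate (r , s) = affine (+ 1) (+ 0) (+ 0) (+ 1) r s

apply-translate : ∀ r p → apply (translate r) p ≡ p ⊕ r
apply-translate (r , s) (x , y) = cong₂ _,_ (lem₁ x y r) (lem₂ x y s)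
  where
  lem₁ : ∀ x y r → + 1 * x + + 0 * y + r ≡ x + r
  lem₁ = solve-∀
  lem₂ : ∀ x y s → + 0 * x + + 1 * y + s ≡ y + s
  lem₂ = solve-∀

-- With p translated to the origin, a strictly positive functional refutes membership. This decides
-- an existential over unboundedly many weights.
hull? : ∀ T p → InHull T p ⊎ ¬ InHull T p
hull? T p@(x , y) with separate-origin (map (apply (translate (- x , - y))) T)
... | inj₁ h = inj₁ (subst₂ InHull (map-inverse back T) (trans (apply-translate p origin) (cong₂ _,_ (+-identityˡ x) (+-identityˡ y)))
    (hull-map (translate p) h))
  where
  undo : ∀ a x → a + - x + x ≡ a
  undo = solve-∀
  back : ∀ q → apply (translate p) (apply (translate (- x , - y)) q) ≡ q
  back q@(a , b) = trans (cong (apply (translate p)) (apply-translate (- x , - y) q))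
    (trans (apply-translate p (a + - x , b + - y)) (cong₂ _,_ (undo a x) (undo b y)))
... | inj₂ (v@(c , d) , pos) = inj₂ λ h → absurd (hull-bound pos
    (subst (InHull _) (trans (apply-translate (- x , - y) p) (cong₂ _,_ (+-inverseʳ x) (+-inverseʳ y)))
      (hull-map (translate (- x , - y)) h)))
  where
  zero-pairing : ∀ c d → + 0 * c + + 0 * d ≡ + 0
  zero-pairing = solve-∀
  absurd : z1 ≤ ⟪ origin , v ⟫ → ⊥
  absurd h = 1≰0 (subst (z1 ≤_) (zero-pairing c d) h)

-- Properness in `_⊊H_` is witnessed by a negated membership; decidability recovers the inclusion
-- when no such witness exists.
⊆H-stable : ∀ {T} S → ¬ Any (λ p → ¬ InHull T p) S → S ⊆H T
⊆H-stable [] _ = []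
⊆H-stable {T} (s ∷ S) h with hull? T s
... | inj₁ p = p ∷ ⊆H-stable S (h ∘ there)
... | inj₂ n = contradiction (here n) h

-- Widths

foldr-⊔ : ∀ x xs → All (_≤ foldr _⊔_ x xs) (x ∷ xs) × foldr _⊔_ x xs ∈ x ∷ xs
foldr-⊔ x [] = ≤-refl ∷ [] , here refl
foldr-⊔ x (y ∷ xs) with foldr _⊔_ x xs | foldr-⊔ x xs
... | m | (hx ∷ hs) , i with ⊔-sel y m
...   | inj₁ e = ≤-trans hx (i≤j⊔i y m) ∷ i≤i⊔j y m ∷ All.map (λ h → ≤-trans h (i≤j⊔i y m)) hs
               , subst (_∈ x ∷ y ∷ xs) (sym e) (there (here refl))
...   | inj₂ e = ≤-trans hx (i≤j⊔i y m) ∷ i≤i⊔j y m ∷ All.map (λ h → ≤-trans h (i≤j⊔i y m)) hs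
               , subst (_∈ x ∷ y ∷ xs) (sym e) (insert i)
  where
  insert : ∀ {m} → m ∈ x ∷ xs → m ∈ x ∷ y ∷ xs
  insert (here e) = here e
  insert (there i) = there (there i)

foldr-⊓ : ∀ x xs → All (foldr _⊓_ x xs ≤_) (x ∷ xs) × foldr _⊓_ x xs ∈ x ∷ xs
foldr-⊓ x [] = ≤-refl ∷ [] , here refl
foldr-⊓ x (y ∷ xs) with foldr _⊓_ x xs | foldr-⊓ x xs
... | m | (hx ∷ hs) , i with ⊓-sel y m
...   | inj₁ e = ≤-trans (i⊓j≤j y m) hx ∷ i⊓j≤i y m ∷ All.map (≤-trans (i⊓j≤j y m)) hs
               , subst (_∈ x ∷ y ∷ xs) (sym e) (there (here refl))
...   | inj₂ e = ≤-trans (i⊓j≤j y m) hx ∷ i⊓j≤i y m ∷ All.map (≤-trans (i⊓j≤j y m)) hs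
               , subst (_∈ x ∷ y ∷ xs) (sym e) (insert i)
  where
  insert : ∀ {m} → m ∈ x ∷ xs → m ∈ x ∷ y ∷ xs
  insert (here e) = here e
  insert (there i) = there (there i)

argmax : ∀ (f : Point → ℤ) S → ¬ (S ≡ []) → ∃ λ p → p ∈ S × All (λ q → f q ≤ f p) S × (maxL (map f S) ≡ f p)
argmax f [] ne = contradiction refl ne
argmax f (s ∷ S) _ with foldr-⊔ (f s) (map f S)
... | hs , i with ∈-map⁻ f {xs = s ∷ S} i
...   | p , j , e = p , j , subst (λ m → All (λ q → f q ≤ m) (s ∷ S)) e (All.map⁻ hs) , e

argmin : ∀ (f : Point → ℤ) S → ¬ (S ≡ []) → ∃ λ p → p ∈ S × All (λ q → f p ≤ f q) S × (minL (map f S) ≡ f p)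
argmin f [] ne = contradiction refl ne
argmin f (s ∷ S) _ with foldr-⊓ (f s) (map f S)
... | hs , i with ∈-map⁻ f {xs = s ∷ S} i
...   | p , j , e = p , j , subst (λ m → All (λ q → m ≤ f q) (s ∷ S)) e (All.map⁻ hs) , e

neg : Point → Point
neg (a , b) = - a , - b

pair-neg : ∀ p v → ⟪ p , neg v ⟫ ≡ - ⟪ p , v ⟫
pair-neg (a , b) (c , d) = ring refl refl
  where
  ring : ∀ {σ τ} → σ ≡ a * - c + b * - d → τ ≡ a * c + b * d → σ ≡ - τ
  ring refl refl = solve (a ⨾ b ⨾ c ⨾ d ⨾ ∅)

hull-bound-above : ∀ {v k T p} → All (λ t → ⟪ t , v ⟫ ≤ k) T → InHull T p → ⟪ p , v ⟫ ≤ k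
hull-bound-above {v} {k} {T} {p} hs h = neg-cancel-≤ (subst (- k ≤_) (pair-neg p v)
  (hull-bound (All.map (λ {t} g → subst (- k ≤_) (sym (pair-neg t v)) (neg-mono-≤ g)) hs) h))

spread : Point → Point → Point → ℤ
spread v p q = ⟪ p , v ⟫ - ⟪ q , v ⟫

nonempty : ∀ {S : List Point} {s} → s ∈ S → ¬ (S ≡ [])
nonempty () refl

lwDir-attained : ∀ v S → ¬ (S ≡ []) → ∃ λ p → ∃ λ q → p ∈ S × q ∈ S × (lwDir v S ≡ spread v p q)
lwDir-attained v S ne with argmax (λ p → ⟪ p , v ⟫) S ne | argmin (λ p → ⟪ p , v ⟫) S ne
... | p , i , _ , e | q , j , _ , e′ = p , q , i , j , cong₂ _-_ e e′

lwDir-hull : ∀ v {S p q} → ¬ (S ≡ []) → InHull S p → InHull S q → spread v p q ≤ lwDir v S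
lwDir-hull v {S} {p} {q} ne hp hq with argmax (λ p → ⟪ p , v ⟫) S ne | argmin (λ p → ⟪ p , v ⟫) S ne
... | _ , _ , max , e | _ , _ , min , e′ = subst₂ (λ a b → spread v p q ≤ a - b) (sym e) (sym e′)
  (+-mono-≤ (hull-bound-above {v} max hp) (neg-mono-≤ (hull-bound {v} min hq)))

lwDir-mono : ∀ v {S T} → ¬ (S ≡ []) → ¬ (T ≡ []) → S ⊆H T → lwDir v S ≤ lwDir v T
lwDir-mono v {S} {T} ne ne′ h with lwDir-attained v S ne
... | p , q , i , j , e = subst (_≤ lwDir v T) (sym e) (lwDir-hull v ne′ (All.lookup h i) (All.lookup h j))

lw-unique : ∀ {S d d′} → IsLw S d → IsLw S d′ → d ≡ d′
lw-unique ((v , p , refl) , h) ((v′ , p′ , refl) , h′) = ≤-antisym (h v′ p′) (h′ v p)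

-- Affine unimodular maps

Δ : Affine → ℤ
Δ φ = a₁₁ φ * a₂₂ φ - a₁₂ φ * a₂₁ φ

Δ²≡1 : ∀ φ → Unimodular φ → Δ φ * Δ φ ≡ + 1
Δ²≡1 φ (inj₁ e) = cong₂ _*_ e e
Δ²≡1 φ (inj₂ e) = cong₂ _*_ e e

-- Dividing the adjugate by Δ = ±1 is the same as multiplying it by Δ.
inverse : Affine → Affine
inverse φ = affine (Δ φ * a₂₂ φ) (- (Δ φ * a₁₂ φ)) (- (Δ φ * a₂₁ φ)) (Δ φ * a₁₁ φ)
  (Δ φ * (a₁₂ φ * t₂ φ - a₂₂ φ * t₁ φ)) (Δ φ * (a₂₁ φ * t₁ φ - a₁₁ φ * t₂ φ))

by-Δ² : ∀ {D x y} → D * D ≡ + 1 → x ≡ D * D * y → x ≡ y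
by-Δ² {y = y} e f = trans f (trans (cong (_* y) e) (*-identityˡ y))

inverse-left : ∀ φ → Unimodular φ → ∀ p → apply (inverse φ) (apply φ p) ≡ p
inverse-left φ u (x , y) = cong₂ _,_
  (by-Δ² {Δ φ} (Δ²≡1 φ u) (ring₁ (a₁₁ φ) (a₁₂ φ) (a₂₁ φ) (a₂₂ φ) (t₁ φ) (t₂ φ) refl))
  (by-Δ² {Δ φ} (Δ²≡1 φ u) (ring₂ (a₁₁ φ) (a₁₂ φ) (a₂₁ φ) (a₂₂ φ) (t₁ φ) (t₂ φ) refl))
  where
  ring₁ : ∀ a b c d r s {D} → D ≡ a * d - b * c →
    D * d * (a * x + b * y + r) + - (D * b) * (c * x + d * y + s) + D * (b * s - d * r) ≡ D * D * x
  ring₁ a b c d r s refl = solve (x ⨾ y ⨾ a ⨾ b ⨾ c ⨾ d ⨾ r ⨾ s ⨾ ∅)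
  ring₂ : ∀ a b c d r s {D} → D ≡ a * d - b * c →
    - (D * c) * (a * x + b * y + r) + D * a * (c * x + d * y + s) + D * (c * r - a * s) ≡ D * D * y
  ring₂ a b c d r s refl = solve (x ⨾ y ⨾ a ⨾ b ⨾ c ⨾ d ⨾ r ⨾ s ⨾ ∅)

inverse-right : ∀ φ → Unimodular φ → ∀ p → apply φ (apply (inverse φ) p) ≡ p
inverse-right φ u (x , y) = cong₂ _,_
  (fix x (t₁ φ) (ring₁ (a₁₁ φ) (a₁₂ φ) (a₂₁ φ) (a₂₂ φ) (t₁ φ) (t₂ φ) refl))
  (fix y (t₂ φ) (ring₂ (a₁₁ φ) (a₁₂ φ) (a₂₁ φ) (a₂₂ φ) (t₁ φ) (t₂ φ) refl))
  where
  fix : ∀ x r {z} → z ≡ Δ φ * Δ φ * (x - r) + r → z ≡ x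
  fix x r e = trans e (trans (cong (λ n → n * (x - r) + r) (Δ²≡1 φ u)) (cancel x r))
    where
    cancel : ∀ x r → + 1 * (x - r) + r ≡ x
    cancel = solve-∀
  ring₁ : ∀ a b c d r s {D} → D ≡ a * d - b * c →
    a * (D * d * x + - (D * b) * y + D * (b * s - d * r)) + b * (- (D * c) * x + D * a * y + D * (c * r - a * s)) + r
    ≡ D * D * (x - r) + r
  ring₁ a b c d r s refl = solve (x ⨾ y ⨾ a ⨾ b ⨾ c ⨾ d ⨾ r ⨾ s ⨾ ∅)
  ring₂ : ∀ a b c d r s {D} → D ≡ a * d - b * c →
    c * (D * d * x + - (D * b) * y + D * (b * s - d * r)) + d * (- (D * c) * x + D * a * y + D * (c * r - a * s)) + s
    ≡ D * D * (y - s) + s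
  ring₂ a b c d r s refl = solve (x ⨾ y ⨾ a ⨾ b ⨾ c ⨾ d ⨾ r ⨾ s ⨾ ∅)

inverse-unimodular : ∀ φ → Unimodular φ → Unimodular (inverse φ)
inverse-unimodular φ u = Sum.map (trans Δ-inverse) (trans Δ-inverse) u
  where
  ring : ∀ a b c d {D} → D ≡ a * d - b * c → D * d * (D * a) - - (D * b) * - (D * c) ≡ D * D * D
  ring a b c d refl = solve (a ⨾ b ⨾ c ⨾ d ⨾ ∅)
  Δ-inverse : Δ (inverse φ) ≡ Δ φ
  Δ-inverse = by-Δ² {Δ φ} (Δ²≡1 φ u) (ring (a₁₁ φ) (a₁₂ φ) (a₂₁ φ) (a₂₂ φ) refl)

_∘A_ : Affine → Affine → Affine
φ ∘A ψ = affine
  (a₁₁ φ * a₁₁ ψ + a₁₂ φ * a₂₁ ψ) (a₁₁ φ * a₁₂ ψ + a₁₂ φ * a₂₂ ψ)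
  (a₂₁ φ * a₁₁ ψ + a₂₂ φ * a₂₁ ψ) (a₂₁ φ * a₁₂ ψ + a₂₂ φ * a₂₂ ψ)
  (a₁₁ φ * t₁ ψ + a₁₂ φ * t₂ ψ + t₁ φ) (a₂₁ φ * t₁ ψ + a₂₂ φ * t₂ ψ + t₂ φ)

apply-∘A : ∀ φ ψ p → apply φ (apply ψ p) ≡ apply (φ ∘A ψ) p
apply-∘A φ ψ (x , y) = cong₂ _,_
  (ring (a₁₁ φ) (a₁₂ φ) (t₁ φ) (a₁₁ ψ) (a₁₂ ψ) (t₁ ψ) (a₂₁ ψ) (a₂₂ ψ) (t₂ ψ) x y)
  (ring (a₂₁ φ) (a₂₂ φ) (t₂ φ) (a₁₁ ψ) (a₁₂ ψ) (t₁ ψ) (a₂₁ ψ) (a₂₂ ψ) (t₂ ψ) x y)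
  where
  ring : ∀ a b r a′ b′ r′ c′ d′ s′ x y →
    a * (a′ * x + b′ * y + r′) + b * (c′ * x + d′ * y + s′) + r
    ≡ (a * a′ + b * c′) * x + (a * b′ + b * d′) * y + (a * r′ + b * s′ + r)
  ring = solve-∀

Δ-∘A : ∀ φ ψ → Δ (φ ∘A ψ) ≡ Δ φ * Δ ψ
Δ-∘A φ ψ = ring (a₁₁ φ) (a₁₂ φ) (a₂₁ φ) (a₂₂ φ) (a₁₁ ψ) (a₁₂ ψ) (a₂₁ ψ) (a₂₂ ψ)
  where
  ring : ∀ a b c d a′ b′ c′ d′ →
    (a * a′ + b * c′) * (c * b′ + d * d′) - (a * b′ + b * d′) * (c * a′ + d * c′)
    ≡ (a * d - b * c) * (a′ * d′ - b′ * c′)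
  ring = solve-∀

∘A-unimodular : ∀ φ ψ → Unimodular φ → Unimodular ψ → Unimodular (φ ∘A ψ)
∘A-unimodular φ ψ (inj₁ e) (inj₁ f) = inj₁ (trans (Δ-∘A φ ψ) (cong₂ _*_ e f))
∘A-unimodular φ ψ (inj₁ e) (inj₂ f) = inj₂ (trans (Δ-∘A φ ψ) (cong₂ _*_ e f))
∘A-unimodular φ ψ (inj₂ e) (inj₁ f) = inj₂ (trans (Δ-∘A φ ψ) (cong₂ _*_ e f))
∘A-unimodular φ ψ (inj₂ e) (inj₂ f) = inj₁ (trans (Δ-∘A φ ψ) (cong₂ _*_ e f))

map-∘A : ∀ φ ψ S → map (apply φ) (map (apply ψ) S) ≡ map (apply (φ ∘A ψ)) S
map-∘A φ ψ S = trans (sym (map-∘ S)) (map-cong (apply-∘A φ ψ) S)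

-- The transpose of the linear part: it pulls functionals back along φ, up to constants that cancel
-- in `spread`.
dual : Affine → Point → Point
dual φ (m , n) = a₁₁ φ * m + a₂₁ φ * n , a₁₂ φ * m + a₂₂ φ * n

spread-apply : ∀ φ v p q → spread v (apply φ p) (apply φ q) ≡ spread (dual φ v) p q
spread-apply φ v@(m , n) p@(x , y) p′@(x′ , y′) = cong-minus ⟪ p , dual φ v ⟫ ⟪ p′ , dual φ v ⟫ (t₁ φ * m + t₂ φ * n)
  (ring (a₁₁ φ) (a₁₂ φ) (a₂₁ φ) (a₂₂ φ) (t₁ φ) (t₂ φ) m n x y)
  (ring (a₁₁ φ) (a₁₂ φ) (a₂₁ φ) (a₂₂ φ) (t₁ φ) (t₂ φ) m n x′ y′)
  where
  ring : ∀ a b c d r s m n x y → (a * x + b * y + r) * m + (c * x + d * y + s) * n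
    ≡ x * (a * m + c * n) + y * (b * m + d * n) + (r * m + s * n)
  ring = solve-∀
  cancel : ∀ u w t → u + t - (w + t) ≡ u - w
  cancel = solve-∀
  cong-minus : ∀ {u w} u′ w′ t → u ≡ u′ + t → w ≡ w′ + t → u - w ≡ u′ - w′
  cong-minus u′ w′ t refl refl = cancel u′ w′ t

dual-inverse : ∀ φ → Unimodular φ → ∀ v → dual φ (dual (inverse φ) v) ≡ v
dual-inverse φ u (m , n) = cong₂ _,_
  (by-Δ² {Δ φ} (Δ²≡1 φ u) (ring₁ (a₁₁ φ) (a₁₂ φ) (a₂₁ φ) (a₂₂ φ) refl))
  (by-Δ² {Δ φ} (Δ²≡1 φ u) (ring₂ (a₁₁ φ) (a₁₂ φ) (a₂₁ φ) (a₂₂ φ) refl))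
  where
  ring₁ : ∀ a b c d {D} → D ≡ a * d - b * c →
    a * (D * d * m + - (D * c) * n) + c * (- (D * b) * m + D * a * n) ≡ D * D * m
  ring₁ a b c d refl = solve (m ⨾ n ⨾ a ⨾ b ⨾ c ⨾ d ⨾ ∅)
  ring₂ : ∀ a b c d {D} → D ≡ a * d - b * c →
    b * (D * d * m + - (D * c) * n) + d * (- (D * b) * m + D * a * n) ≡ D * D * n
  ring₂ a b c d refl = solve (m ⨾ n ⨾ a ⨾ b ⨾ c ⨾ d ⨾ ∅)

-- Primitive vectors

-- The form of primitivity that transports along unimodular maps and supplies the second basis
-- vector for `straighten`.
Bezout : Point → Set
Bezout v = ∃ λ u → ⟪ v , u ⟫ ≡ + 1

∣∣-sign : ∀ i → ∃ λ s → + ∣ i ∣ ≡ i * s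
∣∣-sign (+ n)    = + 1 , sym (*-identityʳ (+ n))
∣∣-sign -[1+ n ] = - (+ 1) , trans (neg-neg (+ suc n)) refl
  where
  neg-neg : ∀ i → i ≡ - i * - (+ 1)
  neg-neg = solve-∀

bezout-signed : ∀ {m n a b s t x y} → m ≡ a * s → n ≡ b * t → + 1 + y * n ≡ x * m →
  a * (s * x) + b * (- (t * y)) ≡ + 1
bezout-signed {a = a} {b} {s} {t} {x} {y} refl refl e =
  trans (shuffle a b s t x y) (trans (cong (_- y * (b * t)) (sym e)) (cancel (y * (b * t))))
  where
  shuffle : ∀ a b s t x y → a * (s * x) + b * (- (t * y)) ≡ x * (a * s) - y * (b * t)
  shuffle = solve-∀
  cancel : ∀ z → + 1 + z - z ≡ + 1
  cancel = solve-∀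

bezout-cast : ∀ x y m n → 1 ℕ.+ y ℕ.* n ≡ x ℕ.* m → + 1 + + y * + n ≡ + x * + m
bezout-cast x y m n e = trans (cong (_+_ (+ 1)) (sym (pos-* y n))) (trans (cong +_ e) (pos-* x m))

primitive⇒bezout : ∀ v → Primitive v → Bezout v
primitive⇒bezout (a , b) p
  with ∣∣-sign a | ∣∣-sign b
     | ℕ.Bézout.identity (subst (ℕ.GCD ∣ a ∣ ∣ b ∣) p (ℕ.gcd-GCD ∣ a ∣ ∣ b ∣))
... | s , es | t , et | ℕ.Bézout.+- x y e =
  (s * + x , - (t * + y)) , bezout-signed {a = a} {b} es et (bezout-cast x y ∣ a ∣ ∣ b ∣ e)
... | s , es | t , et | ℕ.Bézout.-+ x y e =
  (- (s * + x) , t * + y) , trans (+-comm (a * - (s * + x)) (b * (t * + y)))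
    (bezout-signed {a = b} {a} et es (bezout-cast y x ∣ b ∣ ∣ a ∣ e))

bezout⇒primitive : ∀ v → Bezout v → Primitive v
bezout⇒primitive (a , b) ((x , y) , e) = ℕ.∣1⇒≡1 (ℤ.∣⇒∣ᵤ {+ ℕ.gcd ∣ a ∣ ∣ b ∣} {+ 1}
  (subst (+ ℕ.gcd ∣ a ∣ ∣ b ∣ ℤ.∣_) e (ℤ.∣m∣n⇒∣m+n
    (ℤ.∣m⇒∣m*n {m = a} x (ℤ.∣ᵤ⇒∣ {i = a} (ℕ.gcd[m,n]∣m ∣ a ∣ ∣ b ∣)))
    (ℤ.∣m⇒∣m*n {m = b} y (ℤ.∣ᵤ⇒∣ {i = b} (ℕ.gcd[m,n]∣n ∣ a ∣ ∣ b ∣))))))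

primitive≢0 : ∀ {v} → Primitive v → ¬ (v ≡ origin)
primitive≢0 () refl

-- ⟨Aᵀv, A⁻¹u⟩ = ⟨v,u⟩, so the omitted witness is the image of u under the inverse linear part.
bezout-dual : ∀ φ → Unimodular φ → ∀ v → Bezout v → Bezout (dual φ v)
bezout-dual φ u (m , n) ((x , y) , e) = _ ,
  trans (by-Δ² {Δ φ} (Δ²≡1 φ u) (ring (a₁₁ φ) (a₁₂ φ) (a₂₁ φ) (a₂₂ φ) refl)) e
  where
  ring : ∀ a b c d {D} → D ≡ a * d - b * c →
    (a * m + c * n) * (D * d * x + - (D * b) * y) + (b * m + d * n) * (- (D * c) * x + D * a * y)
    ≡ D * D * (m * x + n * y)
  ring a b c d refl = solve (m ⨾ n ⨾ x ⨾ y ⨾ a ⨾ b ⨾ c ⨾ d ⨾ ∅)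

primitive-dual : ∀ φ → Unimodular φ → ∀ v → Primitive v → Primitive (dual φ v)
primitive-dual φ u v p = bezout⇒primitive (dual φ v) (bezout-dual φ u v (primitive⇒bezout v p))

-- Lattice width under unimodular maps

map-nonempty : ∀ {f : Point → Point} {S} → ¬ (S ≡ []) → ¬ (map f S ≡ [])
map-nonempty {S = []} ne _ = ne refl

lwDir-map : ∀ φ v S → ¬ (S ≡ []) → lwDir v (map (apply φ) S) ≡ lwDir (dual φ v) S
lwDir-map φ v S ne = ≤-antisym upper lower
  where
  upper : lwDir v (map (apply φ) S) ≤ lwDir (dual φ v) S
  upper with lwDir-attained v (map (apply φ) S) (map-nonempty ne)
  ... | p , q , i , j , e with ∈-map⁻ (apply φ) i | ∈-map⁻ (apply φ) j
  ...   | p′ , i′ , refl | q′ , j′ , refl = subst (_≤ lwDir (dual φ v) S)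
    (sym (trans e (spread-apply φ v p′ q′))) (lwDir-hull (dual φ v) ne (∈⇒hull i′) (∈⇒hull j′))
  lower : lwDir (dual φ v) S ≤ lwDir v (map (apply φ) S)
  lower with lwDir-attained (dual φ v) S ne
  ... | p , q , i , j , e = subst (_≤ lwDir v (map (apply φ) S))
    (trans (spread-apply φ v p q) (sym e))
    (lwDir-hull v (map-nonempty ne) (∈⇒hull (∈-map⁺ (apply φ) i)) (∈⇒hull (∈-map⁺ (apply φ) j)))

lw-map : ∀ φ {S d} → Unimodular φ → ¬ (S ≡ []) → IsLw S d → IsLw (map (apply φ) S) d
lw-map φ {S} {d} u ne ((v , p , e) , h) =
  ( dual (inverse φ) v , primitive-dual (inverse φ) (inverse-unimodular φ u) v p
  , trans (lwDir-map φ (dual (inverse φ) v) S ne) (trans (cong (λ w → lwDir w S) (dual-inverse φ u v)) e))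
  , λ w q → subst (d ≤_) (sym (lwDir-map φ w S ne)) (h (dual φ w) (primitive-dual φ u w q))

-- Reduction to finding a wide polygon inside the given one

-- A lower bound on all widths, given by explicit pairs of points. Letting v be any non-zero vector
-- means that division with remainder suffices to verify it, without gcds.
Wide : ℤ → List Point → Set
Wide d T = ∀ v → ¬ (v ≡ origin) → ∃ λ p → ∃ λ q → p ∈ T × q ∈ T × (d ≤ spread v p q)

-- Every polygon of width d turns out to contain, up to equivalence, a polygon of one of the
-- five forms that is no thinner; for a minimal polygon the inclusion must be an equality.
Contains : ℤ → List Point → Set
Contains d S = ∃ λ T → OfForm d T × Wide d T × ∃ λ φ → Unimodular φ × (T ⊆H map (apply φ) S)

contains-⊆ : ∀ {d S S′} → S′ ⊆H S → Contains d S′ → Contains d S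
contains-⊆ h (T , form , wide , φ , u , k) = T , form , wide , φ , u , ⊆H-trans k (⊆H-map φ h)

contains-map : ∀ {d S} φ → Unimodular φ → Contains d (map (apply φ) S) → Contains d S
contains-map {S = S} φ u (T , form , wide , ψ , u′ , k) =
  T , form , wide , ψ ∘A φ , ∘A-unimodular ψ φ u′ u , subst (T ⊆H_) (map-∘A ψ φ S) k

wide-nonempty : ∀ {d T} → Wide d T → ¬ (T ≡ [])
wide-nonempty wide refl with wide (+ 1 , + 0) (λ ())
... | _ , _ , () , _

wide-lwDir : ∀ {d T} → Wide d T → ∀ v → Primitive v → d ≤ lwDir v T
wide-lwDir {T = T} wide v p with wide v (primitive≢0 p)
... | _ , _ , i , j , h = ≤-trans h (lwDir-hull v {T} (wide-nonempty wide) (∈⇒hull i) (∈⇒hull j))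

-- In a direction realising the width of S, the width of T is at most d by inclusion and at least d
-- by wideness.
wide-lw : ∀ {d S T} → Wide d T → T ⊆H S → ¬ (S ≡ []) → IsLw S d → IsLw T d
wide-lw {S = S} {T} wide h ne ((v , p , refl) , _) =
  (v , p , ≤-antisym (lwDir-mono v {T} {S} (wide-nonempty wide) ne h) (wide-lwDir wide v p)) , wide-lwDir wide

minimal-strict : ∀ {R S d d′} → Minimal S → IsLw S d → ¬ (R ≡ []) → R ⊆H S → IsLw R d′ → S ⊆H R ⊎ d′ < d
minimal-strict {R} {S} min lwS ne h lwR with Any.any? (λ p → not-hull? p) S
  where
  not-hull? : ∀ p → Dec (¬ InHull R p)
  not-hull? p with hull? R p
  ... | inj₁ i = no (λ n → n i)
  ... | inj₂ n = yes n
... | yes a = inj₂ (min R ne (h , a) _ _ lwS lwR)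
... | no ¬a = inj₁ (⊆H-stable S ¬a)

contains⇒classified : ∀ S → ¬ (S ≡ []) → Minimal S → (d : ℤ) → IsLw S d → Contains d S →
  ∃ λ T → Minimal T × Equivalent S T × OfForm d T
contains⇒classified S ne min d lwS (T , form , wide , φ , u , T⊆φS) =
  T , minimalT , (φ , u , φS⊆T , T⊆φS) , form
  where
  ψ = inverse φ
  uψ = inverse-unimodular φ u
  ψφS : map (apply ψ) (map (apply φ) S) ≡ S
  ψφS = map-inverse (inverse-left φ u) S
  lwT : IsLw T d
  lwT = wide-lw wide T⊆φS (map-nonempty ne) (lw-map φ u ne lwS)
  pull : ∀ {R} → R ⊆H map (apply φ) S → map (apply ψ) R ⊆H S
  pull {R} h = subst (map (apply ψ) R ⊆H_) ψφS (⊆H-map ψ h)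
  push : ∀ {R} → S ⊆H map (apply ψ) R → map (apply φ) S ⊆H R
  push {R} h = subst (map (apply φ) S ⊆H_) (map-inverse (inverse-right φ u) R) (⊆H-map φ h)
  φS⊆T : map (apply φ) S ⊆H T
  -- T pulled back into S has width d again, so the alternative `d < d` is absurd and T exhausts the
  -- image of S.
  φS⊆T = [ push , ⊥-elim ∘ <-irrefl refl ]′
    (minimal-strict min lwS (map-nonempty (wide-nonempty wide)) (pull T⊆φS) (lw-map ψ uψ (wide-nonempty wide) lwT))
  minimalT : Minimal T
  -- If R pulled back exhausted S, then R would contain the image of S and with it T, against
  -- properness.
  minimalT R neR (R⊆T , R≠T) d₁ d₂ lwT₁ lwR =
    [ (λ h → ⊥-elim (All.All¬⇒¬Any (All.map (λ i n → n i) (⊆H-trans T⊆φS (push h))) R≠T))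
    , subst (d₂ <_) (lw-unique {T} lwT lwT₁) ]′
    (minimal-strict min lwS (map-nonempty neR) (pull (⊆H-trans R⊆T T⊆φS)) (lw-map ψ uψ neR lwR))

-- Lower bounds for the widths of the five forms

pattern 0th = here refl
pattern 1st = there 0th
pattern 2nd = there 1st
pattern 3rd = there 2nd
pattern 4th = there 3rd
pattern 5th = there 4th

WideIn : ℤ → List Point → Point → Set
WideIn d T v = ∃ λ p → ∃ λ q → p ∈ T × q ∈ T × (d ≤ spread v p q)

wideIn-neg : ∀ {d T} v → WideIn d T (neg v) → WideIn d T v
wideIn-neg {d} v (p , q , i , j , h) = q , p , j , i ,
  subst (d ≤_) (trans (cong₂ _-_ (pair-neg p v) (pair-neg q v)) (flip ⟪ p , v ⟫ ⟪ q , v ⟫)) h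
  where
  flip : ∀ x y → - x - - y ≡ y - x
  flip = solve-∀

-- The part b (k,1) contributes at least b d, the part r (1,0) at least -r d because px - qx ≥ -d;
-- and b - r ≥ 1.
slope : ∀ {d k r b px py qx qy} → + 0 ≤ d → + 0 ≤ px → qx ≤ d → + 0 ≤ r → z1 + r ≤ b →
  d ≤ px * k + py * + 1 - (qx * k + qy * + 1) →
  d ≤ px * (r + k * b) + py * b - (qx * (r + k * b) + qy * b)
slope {d} {k} {r} {b} {px} {py} {qx} {qy} 0≤d 0≤px qx≤d 0≤r r<b h =
  lin (mul 0≤b h ⊞ mul 0≤r qx≤d ⊞ mul 0≤r 0≤px ⊞ mul 0≤d r<b)
    (solve (d ⨾ k ⨾ r ⨾ b ⨾ px ⨾ py ⨾ qx ⨾ qy ⨾ ∅))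
  where
  0≤b : + 0 ≤ b
  0≤b = ≤-trans (+-mono-≤ 0≤[ 1 ] 0≤r) r<b

-- With k = ⌊a/b⌋ and r = a mod b, the functional (a , b) is b (k , 1) + r (1 , 0).
wide-slopes : ∀ {d T} → + 0 ≤ d → All (λ p → In z0 d (proj₁ p)) T → (∀ k → WideIn d T (k , + 1)) →
  ∀ a n → WideIn d T (a , + suc n)
wide-slopes {d} {T} 0≤d strip slopes a n with slopes (a /ℕ suc n)
... | p@(px , py) , q@(qx , qy) , i , j , h = p , q , i , j ,
  subst (λ a → d ≤ spread (a , + suc n) p q) (sym (a≡a%ℕn+[a/ℕn]*n a (suc n)))
    (slope {d} {a /ℕ suc n} {+ (a %ℕ suc n)} {+ suc n} {px} {py} {qx} {qy}
      0≤d (proj₁ (All.lookup strip i)) (proj₂ (All.lookup strip j)) 0≤[ _ ]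
      (i<j⇒suc[i]≤j (+<+ (n%ℕd<d a (suc n)))) h)

-- The horizontal distance contributes at least 2d, and the heights take away at most d.
steep : ∀ {d k y₁ y₂} → + 0 ≤ d → In z0 d y₁ → In z0 d y₂ → + 2 ≤ k → d ≤ d * k + y₂ * + 1 - (z0 * k + y₁ * + 1)
steep {d} {k} {y₁} {y₂} 0≤d (_ , h) (h′ , _) 2≤k = lin (mul 2≤k 0≤d ⊞ h ⊞ h′) (solve (d ⨾ k ⨾ y₁ ⨾ y₂ ⨾ ∅))

steep′ : ∀ {d k y₁ y₂} → + 0 ≤ d → In z0 d y₁ → In z0 d y₂ → + 2 ≤ - k → d ≤ z0 * k + y₁ * + 1 - (d * k + y₂ * + 1)
steep′ {d} {k} {y₁} {y₂} 0≤d (h , _) (_ , h′) 2≤-k = lin (mul 2≤-k 0≤d ⊞ h ⊞ h′) (solve (d ⨾ k ⨾ y₁ ⨾ y₂ ⨾ ∅))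

level : ∀ {d k y₁ y₂} → + 0 ≤ d → + 1 ≤ k → d ≤ d * k + y₂ * + 0 - (z0 * k + y₁ * + 0)
level {d} {k} {y₁} {y₂} 0≤d 1≤k = lin (mul 1≤k 0≤d) (solve (d ⨾ k ⨾ y₁ ⨾ y₂ ⨾ ∅))

flat : ∀ {d x₁ x₂} → d ≤ x₂ * + 0 + d * + 1 - (x₁ * + 0 + z0 * + 1)
flat {d} {x₁} {x₂} = lin (0≤[ 0 ]) (solve (d ⨾ x₁ ⨾ x₂ ⨾ ∅))

-- Among the slopes (k,1), the points on top and bottom settle k = 0, those on left and right settle
-- |k| ≥ 2, so only k = ±1 must be supplied.
wide-square : ∀ {d T x₁ x₂ y₁ y₂} → + 0 ≤ d → All (λ p → In z0 d (proj₁ p)) T →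
  In z0 d y₁ → In z0 d y₂ → (z0 , y₁) ∈ T → (d , y₂) ∈ T → (x₁ , z0) ∈ T → (x₂ , d) ∈ T →
  WideIn d T (+ 1 , + 1) → WideIn d T (- (+ 1) , + 1) → Wide d T
wide-square {d} {T} {x₁} {x₂} {y₁} {y₂} 0≤d strip hy₁ hy₂ left right bottom top diag anti = wide
  where
  slopes : ∀ k → WideIn d T (k , + 1)
  slopes (+ 0) = _ , _ , top , bottom , flat {d} {x₁} {x₂}
  slopes (+ 1) = diag
  slopes (+ suc (suc n)) = _ , _ , right , left , steep {d} {+ suc (suc n)} 0≤d hy₁ hy₂ (+≤+ (s≤s (s≤s z≤n)))
  slopes -[1+ 0 ] = anti
  slopes -[1+ suc n ] = _ , _ , left , right , steep′ {d} { -[1+ suc n ]} 0≤d hy₁ hy₂ (+≤+ (s≤s (s≤s z≤n)))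
  wide : Wide d T
  wide (+ 0 , + 0) ne = contradiction refl ne
  wide (+ suc m , + 0) _ = _ , _ , right , left , level {d} {+ suc m} {y₁} {y₂} 0≤d (+≤+ (s≤s z≤n))
  wide (-[1+ m ] , + 0) _ = wideIn-neg (-[1+ m ] , + 0)
    (_ , _ , right , left , level {d} {+ suc m} {y₁} {y₂} 0≤d (+≤+ (s≤s z≤n)))
  wide (a , + suc n) _ = wide-slopes 0≤d strip slopes a n
  wide (a , -[1+ n ]) _ = wideIn-neg (a , -[1+ n ]) (wide-slopes 0≤d strip slopes (- a) n)

diagonal : ∀ {d px py qx qy} → d ≤ px + py - (qx + qy) → d ≤ px * + 1 + py * + 1 - (qx * + 1 + qy * + 1)
diagonal {d} {px} {py} {qx} {qy} h = lin h (solve (d ⨾ px ⨾ py ⨾ qx ⨾ qy ⨾ ∅))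

antidiagonal : ∀ {d px py qx qy} → d ≤ py - px - (qy - qx) → d ≤ px * - (+ 1) + py * + 1 - (qx * - (+ 1) + qy * + 1)
antidiagonal {d} {px} {py} {qx} {qy} h = lin h (solve (d ⨾ px ⨾ py ⨾ qx ⨾ qy ⨾ ∅))

ascending : ∀ {d T y₁ y₂} → y₁ ≤ y₂ → (z0 , y₁) ∈ T → (d , y₂) ∈ T → WideIn d T (+ 1 , + 1)
ascending {d} {_} {y₁} {y₂} h left right = _ , _ , right , left , diagonal {d} {d} {y₂} {z0} {y₁} (climb h)
  where
  climb : ∀ {d y₁ y₂} → y₁ ≤ y₂ → d ≤ d + y₂ - (z0 + y₁)
  climb {d} {y₁} {y₂} h = lin h (solve (d ⨾ y₁ ⨾ y₂ ⨾ ∅))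

-- The two points lie on the lines y - x = d - ℓ and y - x = -ℓ. The equation for w lets (ℓ,0) in
-- (T3) match as well as (z + ℓ, z).
across : ∀ {d ℓ T u v w} → w ≡ u + ℓ → (v , v + d - ℓ) ∈ T → (w , u) ∈ T → WideIn d T (- (+ 1) , + 1)
across {d} {ℓ} {_} {u} {v} refl i j = _ , _ , i , j , antidiagonal {d} {v} {v + d - ℓ} {u + ℓ} {u} (gap {d} {ℓ} {u} {v})
  where
  gap : ∀ {d ℓ u v} → d ≤ v + d - ℓ - v - (u - (u + ℓ))
  gap {d} {ℓ} {u} {v} = lin 0≤[ 0 ] (solve (d ⨾ ℓ ⨾ u ⨾ v ⨾ ∅))

-- ⟨·,(1,1)⟩ and ⟨·,(−1,1)⟩ have width at least d on the quadrilateral T2 d x₁ x₂ y₁ y₂.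
Diagonal : ℤ → ℤ → ℤ → ℤ → Set
Diagonal x₁ x₂ y₁ y₂ = x₁ ≤ x₂ ⊎ y₁ ≤ y₂ ⊎ x₁ ≤ y₂ ⊎ y₁ ≤ x₂

AntiDiagonal : ℤ → ℤ → ℤ → ℤ → ℤ → Set
AntiDiagonal d x₁ x₂ y₁ y₂ = x₂ ≤ x₁ ⊎ y₂ ≤ y₁ ⊎ d ≤ x₁ + y₁ ⊎ x₂ + y₂ ≤ d

T1-wide : ∀ {d x y} → In z0 d x → In z0 d y → x + y ≤ d → Wide d (T1 d x y)
T1-wide {d} {x} {y} (0≤x , x≤d) (0≤y , y≤d) h = wide-square 0≤d
  ((≤-refl , 0≤d) ∷ (0≤d , ≤-refl) ∷ (0≤x , x≤d) ∷ []) (≤-refl , 0≤d) (0≤y , y≤d)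
  0th 1st 0th 2nd (ascending 0≤y 0th 1st)
  (_ , _ , 2nd , 1st , antidiagonal {d} {x} {d} {d} {y} (slack h))
  where
  0≤d = ≤-trans 0≤x x≤d
  slack : ∀ {d x y} → x + y ≤ d → d ≤ d - x - (y - d)
  slack {d} {x} {y} h = lin h (solve (d ⨾ x ⨾ y ⨾ ∅))

T2-wide : ∀ {d x₁ x₂ y₁ y₂} → In z0 d x₁ → In z0 d x₂ → In z0 d y₁ → In z0 d y₂ →
  Diagonal x₁ x₂ y₁ y₂ → AntiDiagonal d x₁ x₂ y₁ y₂ → Wide d (T2 d x₁ x₂ y₁ y₂)
T2-wide {d} {x₁} {x₂} {y₁} {y₂} hx₁ hx₂ hy₁ hy₂ δ α = wide-square 0≤d
  (hx₁ ∷ (0≤d , ≤-refl) ∷ hx₂ ∷ (≤-refl , 0≤d) ∷ []) hy₁ hy₂ 3rd 1st 0th 2nd (diag δ) (anti α)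
  where
  0≤d = ≤-trans (proj₁ hx₁) (proj₂ hx₁)
  diag : Diagonal x₁ x₂ y₁ y₂ → WideIn d (T2 d x₁ x₂ y₁ y₂) (+ 1 , + 1)
  diag (inj₁ h) = _ , _ , 2nd , 0th , diagonal {d} {x₂} {d} {x₁} {z0} (ineq h)
    where
    ineq : ∀ {x₁ x₂ d} → x₁ ≤ x₂ → d ≤ x₂ + d - (x₁ + z0)
    ineq {x₁} {x₂} {d} h = lin h (solve (x₁ ⨾ x₂ ⨾ d ⨾ ∅))
  diag (inj₂ (inj₁ h)) = ascending h 3rd 1st
  diag (inj₂ (inj₂ (inj₁ h))) = _ , _ , 1st , 0th , diagonal {d} {d} {y₂} {x₁} {z0} (ineq h)
    where
    ineq : ∀ {x₁ y₂ d} → x₁ ≤ y₂ → d ≤ d + y₂ - (x₁ + z0)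
    ineq {x₁} {y₂} {d} h = lin h (solve (x₁ ⨾ y₂ ⨾ d ⨾ ∅))
  diag (inj₂ (inj₂ (inj₂ h))) = _ , _ , 2nd , 3rd , diagonal {d} {x₂} {d} {z0} {y₁} (ineq h)
    where
    ineq : ∀ {y₁ x₂ d} → y₁ ≤ x₂ → d ≤ x₂ + d - (z0 + y₁)
    ineq {y₁} {x₂} {d} h = lin h (solve (y₁ ⨾ x₂ ⨾ d ⨾ ∅))
  anti : AntiDiagonal d x₁ x₂ y₁ y₂ → WideIn d (T2 d x₁ x₂ y₁ y₂) (- (+ 1) , + 1)
  anti (inj₁ h) = _ , _ , 2nd , 0th , antidiagonal {d} {x₂} {d} {x₁} {z0} (ineq h)
    where
    ineq : ∀ {x₁ x₂ d} → x₂ ≤ x₁ → d ≤ d - x₂ - (z0 - x₁)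
    ineq {x₁} {x₂} {d} h = lin h (solve (x₁ ⨾ x₂ ⨾ d ⨾ ∅))
  anti (inj₂ (inj₁ h)) = _ , _ , 3rd , 1st , antidiagonal {d} {z0} {y₁} {d} {y₂} (ineq h)
    where
    ineq : ∀ {y₁ y₂ d} → y₂ ≤ y₁ → d ≤ y₁ - z0 - (y₂ - d)
    ineq {y₁} {y₂} {d} h = lin h (solve (y₁ ⨾ y₂ ⨾ d ⨾ ∅))
  anti (inj₂ (inj₂ (inj₁ h))) = _ , _ , 3rd , 0th , antidiagonal {d} {z0} {y₁} {x₁} {z0} (ineq {x₁} {y₁} {d} h)
    where
    ineq : ∀ {x₁ y₁ d} → d ≤ x₁ + y₁ → d ≤ y₁ - z0 - (z0 - x₁)
    ineq {x₁} {y₁} {d} h = lin h (solve (x₁ ⨾ y₁ ⨾ d ⨾ ∅))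
  anti (inj₂ (inj₂ (inj₂ h))) = _ , _ , 2nd , 1st , antidiagonal {d} {x₂} {d} {d} {y₂} (ineq h)
    where
    ineq : ∀ {x₂ y₂ d} → x₂ + y₂ ≤ d → d ≤ d - x₂ - (y₂ - d)
    ineq {x₂} {y₂} {d} h = lin h (solve (x₂ ⨾ y₂ ⨾ d ⨾ ∅))

shiftˣ : ∀ {d ℓ x} → In z0 d ℓ → In z0 (d - ℓ) x → In z0 d (x + ℓ)
shiftˣ {d} {ℓ} {x} (0≤ℓ , _) (0≤x , x≤d-ℓ) =
  lin (0≤ℓ ⊞ 0≤x) (solve (d ⨾ ℓ ⨾ x ⨾ ∅)) , lin x≤d-ℓ (solve (d ⨾ ℓ ⨾ x ⨾ ∅))

shiftʸ : ∀ {d ℓ y} → In z0 d ℓ → In z0 ℓ y → In z0 d (y + d - ℓ)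
shiftʸ {d} {ℓ} {y} (_ , ℓ≤d) (0≤y , y≤ℓ) =
  lin (ℓ≤d ⊞ 0≤y) (solve (d ⨾ ℓ ⨾ y ⨾ ∅)) , lin y≤ℓ (solve (d ⨾ ℓ ⨾ y ⨾ ∅))

shiftʸ′ : ∀ {d ℓ y} → In z0 d ℓ → In z0 ℓ y → In z0 d (d - ℓ + y)
shiftʸ′ {d} {ℓ} {y} (_ , ℓ≤d) (0≤y , y≤ℓ) =
  lin (ℓ≤d ⊞ 0≤y) (solve (d ⨾ ℓ ⨾ y ⨾ ∅)) , lin y≤ℓ (solve (d ⨾ ℓ ⨾ y ⨾ ∅))

within : ∀ {d ℓ z} → In z0 d ℓ → In z0 ℓ z → In z0 d z
within (_ , ℓ≤d) (0≤z , z≤ℓ) = 0≤z , ≤-trans z≤ℓ ℓ≤d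

complement : ∀ {d ℓ} → In z0 d ℓ → In z0 d (d - ℓ)
complement {d} {ℓ} (0≤ℓ , ℓ≤d) = lin ℓ≤d (solve (d ⨾ ℓ ⨾ ∅)) , lin 0≤ℓ (solve (d ⨾ ℓ ⨾ ∅))

T3-wide : ∀ {d ℓ x y z} → In z0 d ℓ → In z0 (d - ℓ) x → In z0 ℓ y → In z0 ℓ z → Wide d (T3 d ℓ x y z)
T3-wide {d} {ℓ} hℓ hx hy hz = wide-square 0≤d
  ((≤-refl , 0≤d) ∷ hℓ ∷ (0≤d , ≤-refl) ∷ shiftˣ hℓ hx ∷ within hℓ hz ∷ [])
  (≤-refl , 0≤d) (shiftʸ hℓ hy) 0th 2nd 0th 3rd
  (ascending (proj₁ (shiftʸ hℓ hy)) 0th 2nd) (across (sym (+-identityˡ ℓ)) 4th 1st)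
  where 0≤d = ≤-trans (proj₁ hℓ) (proj₂ hℓ)

T4-wide : ∀ {d ℓ x y z z′} → In z0 d ℓ → In z0 (d - ℓ) x → In z0 ℓ y → In z0 ℓ z → In z0 (d - ℓ) z′ →
  Wide d (T4 d ℓ x y z z′)
T4-wide {d} {ℓ} hℓ hx hy hz hz′ = wide-square 0≤d
  ((≤-refl , 0≤d) ∷ shiftˣ hℓ hz′ ∷ (0≤d , ≤-refl) ∷ shiftˣ hℓ hx ∷ within hℓ hz ∷ [])
  (≤-refl , 0≤d) (shiftʸ hℓ hy) 0th 2nd 0th 3rd
  (ascending (proj₁ (shiftʸ hℓ hy)) 0th 2nd) (across refl 4th 1st)
  where 0≤d = ≤-trans (proj₁ hℓ) (proj₂ hℓ)

T5-wide : ∀ {d ℓ x₁ x₂ y₁ y₂ z₁ z₂} → In z0 d ℓ → In z0 ℓ x₁ → In z0 (d - ℓ) x₂ → In z0 (d - ℓ) y₁ →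
  In z0 ℓ y₂ → In z0 ℓ z₁ → In z0 (d - ℓ) z₂ → Wide d (T5 d ℓ x₁ x₂ y₁ y₂ z₁ z₂)
T5-wide {d} {ℓ} {y₁ = y₁} {y₂} hℓ hx₁ hx₂ hy₁ hy₂ hz₁ hz₂ = wide-square 0≤d
  (within hℓ hx₁ ∷ shiftˣ hℓ hz₂ ∷ (0≤d , ≤-refl) ∷ shiftˣ hℓ hx₂ ∷ within hℓ hz₁ ∷ (≤-refl , 0≤d) ∷ [])
  (within (complement hℓ) hy₁) (shiftʸ′ hℓ hy₂) 5th 2nd 0th 3rd
  (ascending (climb (proj₂ hy₁) (proj₁ hy₂)) 5th 2nd) (across refl 4th 1st)
  where
  0≤d = ≤-trans (proj₁ hℓ) (proj₂ hℓ)
  climb : ∀ {k y₁ y₂} → y₁ ≤ k → z0 ≤ y₂ → y₁ ≤ k + y₂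
  climb {k} {y₁} {y₂} h h′ = lin (h ⊞ h′) (solve (k ⨾ y₁ ⨾ y₂ ⨾ ∅))

-- Quadrilaterals inscribed in the square [0,d]²

contains-form : ∀ {d S T} → OfForm d T → Wide d T → T ⊆H S → Contains d S
contains-form {S = S} {T} form wide h =
  _ , form , wide , translate origin , inj₁ refl , subst (T ⊆H_) (sym identity) h
  where
  unmoved : ∀ p → apply (translate origin) p ≡ p
  unmoved (x , y) = trans (apply-translate origin (x , y)) (cong₂ _,_ (+-identityʳ x) (+-identityʳ y))
  identity : map (apply (translate origin)) S ≡ S
  identity = trans (map-cong unmoved S) (map-id S)

contains-via : ∀ {d S S′} φ → Unimodular φ → All (_∈ map (apply φ) S) S′ → Contains d S′ → Contains d S
contains-via φ u h c = contains-map φ u (contains-⊆ (⊆⇒⊆H h) c)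

≤∧≢⇒suc≤ : ∀ {x y} → x ≤ y → ¬ (x ≡ y) → z1 + x ≤ y
≤∧≢⇒suc≤ h ne = i<j⇒suc[i]≤j (≤∧≢⇒< h ne)

interior : ∀ {m x} → In z0 m x → ¬ (x ≡ z0) → ¬ (x ≡ m) → In z1 (m - z1) x
interior {m} {x} (0≤x , x≤m) x≢0 x≢m =
  lin (≤∧≢⇒suc≤ 0≤x (x≢0 ∘ sym)) (solve (m ⨾ x ⨾ ∅)) , lin (≤∧≢⇒suc≤ x≤m x≢m) (solve (m ⨾ x ⨾ ∅))

-- The min-max conditions of (T2) amount to four possible comparisons, one for each pair of points
-- that can realise a diagonal width.
meet≤join : ∀ {a b c e} → a ≤ c ⊎ b ≤ e ⊎ a ≤ e ⊎ b ≤ c → a ⊓ b ≤ c ⊔ e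
meet≤join {a} {b} {c} {e} (inj₁ h) = ≤-trans (i⊓j≤i a b) (≤-trans h (i≤i⊔j c e))
meet≤join {a} {b} {c} {e} (inj₂ (inj₁ h)) = ≤-trans (i⊓j≤j a b) (≤-trans h (i≤j⊔i c e))
meet≤join {a} {b} {c} {e} (inj₂ (inj₂ (inj₁ h))) = ≤-trans (i⊓j≤i a b) (≤-trans h (i≤j⊔i c e))
meet≤join {a} {b} {c} {e} (inj₂ (inj₂ (inj₂ h))) = ≤-trans (i⊓j≤j a b) (≤-trans h (i≤i⊔j c e))

flip≤ : ∀ {d x y} → x ≤ y → d - y ≤ d - x
flip≤ {d} {x} {y} h = lin h (solve (d ⨾ x ⨾ y ⨾ ∅))

≤sum : ∀ {d x y} → d ≤ x + y → d - x ≤ y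
≤sum {d} {x} {y} h = lin h (solve (d ⨾ x ⨾ y ⨾ ∅))

sum≤ : ∀ {d x y} → x + y ≤ d → y ≤ d - x
sum≤ {d} {x} {y} h = lin h (solve (d ⨾ x ⨾ y ⨾ ∅))

antiDiagonal⇒ : ∀ {d x₁ x₂ y₁ y₂} → AntiDiagonal d x₁ x₂ y₁ y₂ → (d - x₁) ⊓ y₂ ≤ (d - x₂) ⊔ y₁
antiDiagonal⇒ {d} {x₁} {x₂} {y₁} {y₂} (inj₁ h) = meet≤join (inj₁ (flip≤ {d} h))
antiDiagonal⇒ (inj₂ (inj₁ h)) = meet≤join (inj₂ (inj₁ h))
antiDiagonal⇒ {d} {x₁} {x₂} {y₁} {y₂} (inj₂ (inj₂ (inj₁ h))) = meet≤join (inj₂ (inj₂ (inj₁ (≤sum {d} {x₁} h))))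
antiDiagonal⇒ {d} {x₁} {x₂} {y₁} {y₂} (inj₂ (inj₂ (inj₂ h))) = meet≤join (inj₂ (inj₂ (inj₂ (sum≤ {d} {x₂} h))))

-- Unlike in (T2), points may sit at corners of the square; such cases lead to (T1), or to (T2) in
-- other coordinates.
record Quad (d x₁ x₂ y₁ y₂ : ℤ) : Set where
  constructor quad
  field
    hx₁ : In z0 d x₁
    hx₂ : In z0 d x₂
    hy₁ : In z0 d y₁
    hy₂ : In z0 d y₂
    δ   : Diagonal x₁ x₂ y₁ y₂
    α   : AntiDiagonal d x₁ x₂ y₁ y₂

T1-contained : ∀ {d x y S} → In z0 d x → In z0 d y → x + y ≤ d →
  (z0 , z0) ∈ S → (d , y) ∈ S → (x , d) ∈ S → Contains d S
T1-contained hx hy h i j k =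
  contains-form (inj₁ (_ , _ , hx , hy , h , refl)) (T1-wide hx hy h) (⊆⇒⊆H (i ∷ j ∷ k ∷ []))

widen : ∀ {m x} → In z1 (m - z1) x → In z0 m x
widen {m} {x} (1≤x , x≤m-1) = ≤-trans 0≤[ 1 ] 1≤x , lin (x≤m-1 ⊞ 0≤[ 1 ]) (solve (m ⨾ x ⨾ ∅))

T2-contained : ∀ {d x₁ x₂ y₁ y₂} →
  In z1 (d - z1) x₁ → In z1 (d - z1) x₂ → In z1 (d - z1) y₁ → In z1 (d - z1) y₂ →
  Diagonal x₁ x₂ y₁ y₂ → AntiDiagonal d x₁ x₂ y₁ y₂ → Contains d (T2 d x₁ x₂ y₁ y₂)
T2-contained hx₁ hx₂ hy₁ hy₂ δ α = contains-form
  (inj₂ (inj₁ (_ , _ , _ , _ , hx₁ , hx₂ , hy₁ , hy₂ , meet≤join δ , antiDiagonal⇒ α , refl)))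
  (T2-wide (widen hx₁) (widen hx₂) (widen hy₁) (widen hy₂) δ α) ⊆H-refl

transposition : Affine
transposition = affine z0 z1 z1 z0 z0 z0

transposed : ∀ x y → (y , x) ≡ apply transposition (x , y)
transposed x y = cong₂ _,_ (first x y) (second x y)
  where
  first : ∀ x y → y ≡ z0 * x + z1 * y + z0
  first = solve-∀
  second : ∀ x y → x ≡ z1 * x + z0 * y + z0
  second = solve-∀

quad-transpose : ∀ {d x₁ x₂ y₁ y₂} → Contains d (T2 d y₁ y₂ x₁ x₂) → Contains d (T2 d x₁ x₂ y₁ y₂)
quad-transpose {d} {x₁} {x₂} {y₁} {y₂} = contains-via transposition (inj₂ refl)
  (there (there (there (here (transposed z0 y₁)))) ∷ there (there (here (transposed x₂ d)))
  ∷ there (here (transposed d y₂)) ∷ here (transposed x₁ z0) ∷ [])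

Quad-transpose : ∀ {d x₁ x₂ y₁ y₂} → Quad d x₁ x₂ y₁ y₂ → Quad d y₁ y₂ x₁ x₂
Quad-transpose {d} {x₁} {x₂} {y₁} {y₂} (quad hx₁ hx₂ hy₁ hy₂ δ α) = quad hy₁ hy₂ hx₁ hx₂ (diag δ) (anti α)
  where
  diag : Diagonal x₁ x₂ y₁ y₂ → Diagonal y₁ y₂ x₁ x₂
  diag (inj₁ h) = inj₂ (inj₁ h)
  diag (inj₂ (inj₁ h)) = inj₁ h
  diag (inj₂ (inj₂ (inj₁ h))) = inj₂ (inj₂ (inj₂ h))
  diag (inj₂ (inj₂ (inj₂ h))) = inj₂ (inj₂ (inj₁ h))
  anti : AntiDiagonal d x₁ x₂ y₁ y₂ → AntiDiagonal d y₁ y₂ x₁ x₂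
  anti (inj₁ h) = inj₂ (inj₁ h)
  anti (inj₂ (inj₁ h)) = inj₁ h
  anti (inj₂ (inj₂ (inj₁ h))) = inj₂ (inj₂ (inj₁ (subst (d ≤_) (+-comm x₁ y₁) h)))
  anti (inj₂ (inj₂ (inj₂ h))) = inj₂ (inj₂ (inj₂ (subst (_≤ d) (+-comm x₂ y₂) h)))

reflection : ℤ → Affine
reflection d = affine z1 z0 z0 (- z1) z0 d

reflected : ∀ d x y {y′} → y′ ≡ d - y → (x , y′) ≡ apply (reflection d) (x , y)
reflected d x y refl = cong₂ _,_ (first x y) (second d x y)
  where
  first : ∀ x y → x ≡ z1 * x + z0 * y + z0
  first = solve-∀
  second : ∀ d x y → d - y ≡ z0 * x + - z1 * y + d
  second = solve-∀

quad-reflect : ∀ {d x₁ x₂ y₁ y₂} → Contains d (T2 d x₂ x₁ (d - y₁) (d - y₂)) → Contains d (T2 d x₁ x₂ y₁ y₂)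
quad-reflect {d} {x₁} {x₂} {y₁} {y₂} = contains-via (reflection d) (inj₂ refl)
  (there (there (here (reflected d x₂ d (sym (+-inverseʳ d))))) ∷ there (here (reflected d d y₂ refl))
  ∷ here (reflected d x₁ z0 (sym (+-identityʳ d))) ∷ there (there (there (here (reflected d z0 y₁ refl)))) ∷ [])

-- The reflection interchanges the directions (1,1) and (-1,1), so `δ` and `α` trade places.
Quad-reflect : ∀ {d x₁ x₂ y₁ y₂} → Quad d x₁ x₂ y₁ y₂ → Quad d x₂ x₁ (d - y₁) (d - y₂)
Quad-reflect {d} {x₁} {x₂} {y₁} {y₂} (quad hx₁ hx₂ hy₁ hy₂ δ α) =
  quad hx₂ hx₁ (complement hy₁) (complement hy₂) (diag α) (anti δ)
  where
  diag : AntiDiagonal d x₁ x₂ y₁ y₂ → Diagonal x₂ x₁ (d - y₁) (d - y₂)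
  diag (inj₁ h) = inj₁ h
  diag (inj₂ (inj₁ h)) = inj₂ (inj₁ (flip≤ {d} h))
  diag (inj₂ (inj₂ (inj₁ h))) = inj₂ (inj₂ (inj₂ (≤sum {d} {y₁} {x₁} (subst (d ≤_) (+-comm x₁ y₁) h))))
  diag (inj₂ (inj₂ (inj₂ h))) = inj₂ (inj₂ (inj₁ (sum≤ {d} {y₂} {x₂} (subst (_≤ d) (+-comm x₂ y₂) h))))
  above : ∀ {d x y} → y ≤ x → d ≤ x + (d - y)
  above {d} {x} {y} h = lin h (solve (d ⨾ x ⨾ y ⨾ ∅))
  below : ∀ {d x y} → x ≤ y → x + (d - y) ≤ d
  below {d} {x} {y} h = lin h (solve (d ⨾ x ⨾ y ⨾ ∅))
  anti : Diagonal x₁ x₂ y₁ y₂ → AntiDiagonal d x₂ x₁ (d - y₁) (d - y₂)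
  anti (inj₁ h) = inj₁ h
  anti (inj₂ (inj₁ h)) = inj₂ (inj₁ (flip≤ {d} h))
  anti (inj₂ (inj₂ (inj₁ h))) = inj₂ (inj₂ (inj₂ (below h)))
  anti (inj₂ (inj₂ (inj₂ h))) = inj₂ (inj₂ (inj₁ (above h)))

shear : ℤ → Affine
shear c = affine z1 z0 (- z1) z1 z0 c

sheared : ∀ c x y {y′} → y′ ≡ y - x + c → (x , y′) ≡ apply (shear c) (x , y)
sheared c x y refl = cong₂ _,_ (first x y) (second c x y)
  where
  first : ∀ x y → x ≡ z1 * x + z0 * y + z0
  first = solve-∀
  second : ∀ c x y → y - x + c ≡ - z1 * x + z1 * y + c
  second = solve-∀

-- The bottom edge contains (x₂,0), so the polygon contains a vertical chord of length d. The shear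
-- `y − x + x₂` fixes both its ends and moves (0,0) and (d,y₂) to heights x₂ and x₂ + y₂ - d,
-- strictly inside their sides.
corner-shear : ∀ {d x₁ x₂ y₂} → In z0 d x₁ → In z0 d y₂ → x₂ ≤ x₁ → z1 + d ≤ x₂ + y₂ → z1 + x₂ ≤ d →
  Contains d (T2 d x₁ x₂ z0 y₂)
corner-shear {d} {x₁} {x₂} {y₂} (_ , x₁≤d) (_ , y₂≤d) x₂≤x₁ d<x₂+y₂ x₂<d =
  contains-⊆ (foot ∷ ∈⇒hull 1st ∷ ∈⇒hull 2nd ∷ ∈⇒hull 3rd ∷ [])
    (contains-via {S = T2 d x₂ x₂ z0 y₂} (shear x₂) (inj₁ refl)
      (here (sheared x₂ x₂ z0 (eq₁ x₂)) ∷ there (here (sheared x₂ d y₂ (eq₂ x₂ y₂ d)))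
        ∷ there (there (here (sheared x₂ x₂ d (eq₃ x₂ d)))) ∷ there (there (there (here (sheared x₂ z0 z0 (eq₄ x₂))))) ∷ [])
      (T2-contained hx₂ hx₂ hx₂ (high {d} {x₂} {y₂} d<x₂+y₂ , low {d} {x₂} {y₂} y₂≤d x₂<d) (inj₁ ≤-refl) (inj₁ ≤-refl)))
  where
  eq₁ : ∀ x → z0 ≡ z0 - x + x
  eq₁ = solve-∀
  eq₂ : ∀ x y d → x + y - d ≡ y - d + x
  eq₂ = solve-∀
  eq₃ : ∀ x d → d ≡ d - x + x
  eq₃ = solve-∀
  eq₄ : ∀ x → x ≡ z0 - z0 + x
  eq₄ = solve-∀
  high : ∀ {d x y} → z1 + d ≤ x + y → z1 ≤ x + y - d
  high {d} {x} {y} h = lin h (solve (d ⨾ x ⨾ y ⨾ ∅))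
  low : ∀ {d x y} → y ≤ d → z1 + x ≤ d → x + y - d ≤ d - z1
  low {d} {x} {y} h h′ = lin (h ⊞ h′) (solve (d ⨾ x ⨾ y ⨾ ∅))
  1≤x₂ : ∀ {d x y} → y ≤ d → z1 + d ≤ x + y → z1 ≤ x
  1≤x₂ {d} {x} {y} h h′ = lin (h ⊞ h′) (solve (d ⨾ x ⨾ y ⨾ ∅))
  x₂≤d-1 : ∀ {d x} → z1 + x ≤ d → x ≤ d - z1
  x₂≤d-1 {d} {x} h = lin h (solve (d ⨾ x ⨾ ∅))
  hx₂ : In z1 (d - z1) x₂
  hx₂ = 1≤x₂ y₂≤d d<x₂+y₂ , x₂≤d-1 x₂<d
  foot : InHull (T2 d x₁ x₂ z0 y₂) (x₂ , z0)
  foot = hull₂ x₂ (x₁ - x₂) x₂ z0 (∈⇒hull 0th) (∈⇒hull 3rd) (≤-trans 0≤[ 1 ] (proj₁ hx₂))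
    (i≤j⇒0≤j-i x₂≤x₁) (total (proj₁ hx₂) x₂≤x₁) (eqˣ x₁ x₂) (eqʸ x₁ x₂)
    where
    total : ∀ {x₁ x₂} → z1 ≤ x₂ → x₂ ≤ x₁ → z1 ≤ x₂ + (x₁ - x₂)
    total {x₁} {x₂} h h′ = lin (h ⊞ h′) (solve (x₁ ⨾ x₂ ⨾ ∅))
    eqˣ : ∀ x₁ x₂ → (x₂ + (x₁ - x₂)) * x₂ ≡ x₂ * x₁ + (x₁ - x₂) * z0
    eqˣ = solve-∀
    eqʸ : ∀ x₁ x₂ → (x₂ + (x₁ - x₂)) * z0 ≡ x₂ * z0 + (x₁ - x₂) * z0
    eqʸ = solve-∀

-- With (0,0) in the polygon, x₂ + y₂ ≤ d gives (T1) directly, and so does x₁ = d, through the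
-- corner (d,0). Otherwise `α` leaves only x₂ ≤ x₁, which the shear handles.
corner : ∀ {d x₁ x₂ y₂} → Quad d x₁ x₂ z0 y₂ → Contains d (T2 d x₁ x₂ z0 y₂)
corner {d} {x₁} {x₂} {y₂} (quad hx₁ hx₂ _ hy₂ _ α) = go α
  where
  small : x₂ + y₂ ≤ d → Contains d (T2 d x₁ x₂ z0 y₂)
  small h = T1-contained hx₂ hy₂ h 3rd 1st 2nd
  right-angled : x₁ ≡ d → Contains d (T2 d x₁ x₂ z0 y₂)
  right-angled refl = T1-contained hx₂ (≤-refl , ≤-trans (proj₁ hx₁) (proj₂ hx₁))
    (subst (_≤ d) (sym (+-identityʳ x₂)) (proj₂ hx₂)) 3rd 0th 2nd
  sloped : x₂ ≤ x₁ → x₂ + y₂ ≤ d ⊎ z1 + d ≤ x₂ + y₂ → d ≤ x₂ ⊎ z1 + x₂ ≤ d → Contains d (T2 d x₁ x₂ z0 y₂)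
  sloped _ (inj₁ h) _ = small h
  sloped h (inj₂ _) (inj₁ k) = right-angled (≤-antisym (proj₂ hx₁) (≤-trans k h))
  sloped h (inj₂ l) (inj₂ k) = corner-shear hx₁ hy₂ h l k
  add : ∀ {x y d} → x ≤ d → y ≤ z0 → x + y ≤ d
  add {x} {y} {d} h h′ = lin (h ⊞ h′) (solve (x ⨾ y ⨾ d ⨾ ∅))
  go : AntiDiagonal d x₁ x₂ z0 y₂ → Contains d (T2 d x₁ x₂ z0 y₂)
  go (inj₁ h) = sloped h (split _ _) (split _ _)
  go (inj₂ (inj₁ h)) = small (add (proj₂ hx₂) h)
  go (inj₂ (inj₂ (inj₁ h))) = right-angled (≤-antisym (proj₂ hx₁) (subst (d ≤_) (+-identityʳ x₁) h))
  go (inj₂ (inj₂ (inj₂ h))) = small h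

Extreme : ℤ → ℤ → Set
Extreme d x = x ≡ z0 ⊎ x ≡ d

extreme? : ∀ {d x} → In z0 d x → Extreme d x ⊎ In z1 (d - z1) x
extreme? {d} {x} h with x ≟ z0 | x ≟ d
... | yes e | _     = inj₁ (inj₁ e)
... | no _  | yes e = inj₁ (inj₂ e)
... | no n  | no n′ = inj₂ (interior h n n′)

-- An end of the left side is a corner of the square, and reflection brings the upper one to the
-- lower. The other sides follow by symmetries of the square.
quad-y₁ : ∀ {d x₁ x₂ y₁ y₂} → Quad d x₁ x₂ y₁ y₂ → Extreme d y₁ → Contains d (T2 d x₁ x₂ y₁ y₂)
quad-y₁ q (inj₁ refl) = corner q
quad-y₁ {d} {x₁} {x₂} {y₁} {y₂} q (inj₂ refl) = quad-reflect
  (subst (λ y → Contains d (T2 d x₂ x₁ y (d - y₂))) (sym (+-inverseʳ d))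
    (corner (subst (λ y → Quad d x₂ x₁ y (d - y₂)) (+-inverseʳ d) (Quad-reflect q))))

quad-x₁ : ∀ {d x₁ x₂ y₁ y₂} → Quad d x₁ x₂ y₁ y₂ → Extreme d x₁ → Contains d (T2 d x₁ x₂ y₁ y₂)
quad-x₁ q e = quad-transpose (quad-y₁ (Quad-transpose q) e)

quad-x₂ : ∀ {d x₁ x₂ y₁ y₂} → Quad d x₁ x₂ y₁ y₂ → Extreme d x₂ → Contains d (T2 d x₁ x₂ y₁ y₂)
quad-x₂ q e = quad-reflect (quad-x₁ (Quad-reflect q) e)

quad-y₂ : ∀ {d x₁ x₂ y₁ y₂} → Quad d x₁ x₂ y₁ y₂ → Extreme d y₂ → Contains d (T2 d x₁ x₂ y₁ y₂)
quad-y₂ q e = quad-transpose (quad-x₂ (Quad-transpose q) e)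

quad-contains : ∀ {d x₁ x₂ y₁ y₂} → Quad d x₁ x₂ y₁ y₂ → Contains d (T2 d x₁ x₂ y₁ y₂)
quad-contains q@(quad hx₁ hx₂ hy₁ hy₂ δ α) with extreme? hx₁ | extreme? hx₂ | extreme? hy₁ | extreme? hy₂
... | inj₁ e | _ | _ | _ = quad-x₁ q e
... | inj₂ _ | inj₁ e | _ | _ = quad-x₂ q e
... | inj₂ _ | inj₂ _ | inj₁ e | _ = quad-y₁ q e
... | inj₂ _ | inj₂ _ | inj₂ _ | inj₁ e = quad-y₂ q e
... | inj₂ a | inj₂ b | inj₂ c | inj₂ e = T2-contained a b c e δ α

-- Hexagons whose edges have the normals (1,0), (0,1), (1,−1)

-- The side lengths ℓ and d − ℓ alternate; the other entries locate one marked point on each side.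
record Marking : Set where
  constructor marking
  field ℓ x₁ x₂ y₁ y₂ z₁ z₂ : ℤ

marked : ℤ → Marking → List Point
marked d (marking ℓ x₁ x₂ y₁ y₂ z₁ z₂) = T5 d ℓ x₁ x₂ y₁ y₂ z₁ z₂

record Valid (d : ℤ) (h : Marking) : Set where
  constructor valid
  open Marking h
  field
    hℓ  : In z0 d ℓ
    hx₁ : In z0 ℓ x₁
    hx₂ : In z0 (d - ℓ) x₂
    hy₁ : In z0 (d - ℓ) y₁
    hy₂ : In z0 ℓ y₂
    hz₁ : In z0 ℓ z₁
    hz₂ : In z0 (d - ℓ) z₂

-- Vertex i of the hexagon, counted counterclockwise from (0,0), is marked.
V₀ V₁ V₂ V₃ V₄ V₅ : ℤ → Marking → Set
V₀ d (marking ℓ x₁ x₂ y₁ y₂ z₁ z₂) = x₁ ≡ z0 ⊎ y₁ ≡ z0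
V₁ d (marking ℓ x₁ x₂ y₁ y₂ z₁ z₂) = x₁ ≡ ℓ ⊎ z₂ ≡ z0
V₂ d (marking ℓ x₁ x₂ y₁ y₂ z₁ z₂) = z₂ ≡ d - ℓ ⊎ y₂ ≡ z0
V₃ d (marking ℓ x₁ x₂ y₁ y₂ z₁ z₂) = y₂ ≡ ℓ ⊎ x₂ ≡ d - ℓ
V₄ d (marking ℓ x₁ x₂ y₁ y₂ z₁ z₂) = x₂ ≡ z0 ⊎ z₁ ≡ ℓ
V₅ d (marking ℓ x₁ x₂ y₁ y₂ z₁ z₂) = z₁ ≡ z0 ⊎ y₁ ≡ d - ℓ

-- The marking of the image under `turn (d − ℓ)`, whose linear part has order six; vertex i goes to
-- vertex i + 1 modulo 6.
rotate : ℤ → Marking → Marking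
rotate d (marking ℓ x₁ x₂ y₁ y₂ z₁ z₂) = marking (d - ℓ) (d - ℓ - y₁) (ℓ - y₂) z₁ z₂ x₂ x₁

turn : ℤ → Affine
turn c = affine z1 (- z1) z1 z0 c z0

turned : ∀ c x y {x′ y′} → x′ ≡ x - y + c → y′ ≡ x → (x′ , y′) ≡ apply (turn c) (x , y)
turned c x y refl refl = cong₂ _,_ (first c x y) (second x y)
  where
  first : ∀ c x y → x - y + c ≡ z1 * x + - z1 * y + c
  first = solve-∀
  second : ∀ x y → x ≡ z1 * x + z0 * y + z0
  second = solve-∀

involutive : ∀ d ℓ → ℓ ≡ d - (d - ℓ)
involutive = solve-∀

rotate-contains : ∀ {d} h → Contains d (marked d (rotate d h)) → Contains d (marked d h)
rotate-contains {d} (marking ℓ x₁ x₂ y₁ y₂ z₁ z₂) = contains-via (turn (d - ℓ)) (inj₁ refl)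
  ( there (there (there (there (there (here (turned c z0 y₁ (left₁ d ℓ y₁) refl))))))
  ∷ here (turned c x₁ z0 (bottom₁ d ℓ x₁) refl)
  ∷ there (here (turned c (z₂ + ℓ) z₂ (right₁ d ℓ z₂) (right₂ d ℓ z₂)))
  ∷ there (there (here (turned c d (d - ℓ + y₂) (top₁ d ℓ y₂) refl)))
  ∷ there (there (there (here (turned c (x₂ + ℓ) d (upper₁ d ℓ x₂) (upper₂ d ℓ x₂)))))
  ∷ there (there (there (there (here (turned c z₁ (z₁ + d - ℓ) (origin₁ d ℓ z₁) refl)))))
  ∷ [])
  where
  c = d - ℓ
  left₁ : ∀ d ℓ y → d - ℓ - y ≡ z0 - y + (d - ℓ)
  left₁ = solve-∀
  bottom₁ : ∀ d ℓ x → x + (d - ℓ) ≡ x - z0 + (d - ℓ)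
  bottom₁ = solve-∀
  right₁ : ∀ d ℓ z → d ≡ z + ℓ - z + (d - ℓ)
  right₁ = solve-∀
  right₂ : ∀ d ℓ z → d - (d - ℓ) + z ≡ z + ℓ
  right₂ = solve-∀
  top₁ : ∀ d ℓ y → ℓ - y + (d - ℓ) ≡ d - (d - ℓ + y) + (d - ℓ)
  top₁ = solve-∀
  upper₁ : ∀ d ℓ x → x ≡ x + ℓ - d + (d - ℓ)
  upper₁ = solve-∀
  upper₂ : ∀ d ℓ x → x + d - (d - ℓ) ≡ x + ℓ
  upper₂ = solve-∀
  origin₁ : ∀ d ℓ z → z0 ≡ z - (z + d - ℓ) + (d - ℓ)
  origin₁ = solve-∀

rotate-valid : ∀ {d} h → Valid d h → Valid d (rotate d h)
rotate-valid {d} (marking ℓ x₁ x₂ y₁ y₂ z₁ z₂) (valid hℓ hx₁ hx₂ hy₁ hy₂ hz₁ hz₂) =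
  valid (complement hℓ) (complement hy₁) (cast (complement hy₂)) (cast hz₁) hz₂ hx₂ (cast hx₁)
  where
  cast : ∀ {x} → In z0 ℓ x → In z0 (d - (d - ℓ)) x
  cast {x} = subst (λ m → In z0 m x) (involutive d ℓ)

minus-zero : ∀ m {x} → x ≡ z0 → m - x ≡ m
minus-zero m refl = +-identityʳ m

minus-self : ∀ m {x} → x ≡ m → m - x ≡ z0
minus-self m refl = +-inverseʳ m

V₀→V₁ : ∀ d h → V₀ d h → V₁ d (rotate d h)
V₀→V₁ d h (inj₁ e) = inj₂ e
V₀→V₁ d h (inj₂ e) = inj₁ (minus-zero _ e)

V₁→V₂ : ∀ d h → V₁ d h → V₂ d (rotate d h)
V₁→V₂ d h (inj₁ e) = inj₁ (trans e (involutive d _))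
V₁→V₂ d h (inj₂ e) = inj₂ e

V₂→V₃ : ∀ d h → V₂ d h → V₃ d (rotate d h)
V₂→V₃ d h (inj₁ e) = inj₁ e
V₂→V₃ d h (inj₂ e) = inj₂ (trans (minus-zero _ e) (involutive d _))

V₃→V₄ : ∀ d h → V₃ d h → V₄ d (rotate d h)
V₃→V₄ d h (inj₁ e) = inj₁ (minus-self _ e)
V₃→V₄ d h (inj₂ e) = inj₂ e

V₄→V₅ : ∀ d h → V₄ d h → V₅ d (rotate d h)
V₄→V₅ d h (inj₁ e) = inj₁ e
V₄→V₅ d h (inj₂ e) = inj₂ (trans e (involutive d _))

V₅→V₀ : ∀ d h → V₅ d h → V₀ d (rotate d h)
V₅→V₀ d h (inj₁ e) = inj₂ e
V₅→V₀ d h (inj₂ e) = inj₁ (minus-self _ e)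

V₀? : ∀ d h → Dec (V₀ d h)
V₀? d (marking ℓ x₁ x₂ y₁ y₂ z₁ z₂) = (x₁ ≟ z0) ⊎-dec (y₁ ≟ z0)

V₁? : ∀ d h → Dec (V₁ d h)
V₁? d (marking ℓ x₁ x₂ y₁ y₂ z₁ z₂) = (x₁ ≟ ℓ) ⊎-dec (z₂ ≟ z0)

V₂? : ∀ d h → Dec (V₂ d h)
V₂? d (marking ℓ x₁ x₂ y₁ y₂ z₁ z₂) = (z₂ ≟ d - ℓ) ⊎-dec (y₂ ≟ z0)

V₃? : ∀ d h → Dec (V₃ d h)
V₃? d (marking ℓ x₁ x₂ y₁ y₂ z₁ z₂) = (y₂ ≟ ℓ) ⊎-dec (x₂ ≟ d - ℓ)

V₄? : ∀ d h → Dec (V₄ d h)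
V₄? d (marking ℓ x₁ x₂ y₁ y₂ z₁ z₂) = (x₂ ≟ z0) ⊎-dec (z₁ ≟ ℓ)

V₅? : ∀ d h → Dec (V₅ d h)
V₅? d (marking ℓ x₁ x₂ y₁ y₂ z₁ z₂) = (z₁ ≟ z0) ⊎-dec (y₁ ≟ d - ℓ)

vertex₀ : ∀ d h → V₀ d h → (z0 , z0) ∈ marked d h
vertex₀ d h (inj₁ e) = here (cong (_, z0) (sym e))
vertex₀ d h (inj₂ e) = there (there (there (there (there (here (cong (z0 ,_) (sym e)))))))

vertex₁ : ∀ d h → V₁ d h → (Marking.ℓ h , z0) ∈ marked d h
vertex₁ d h (inj₁ e) = here (cong (_, z0) (sym e))
vertex₁ d (marking ℓ _ _ _ _ _ _) (inj₂ refl) = there (here (cong (_, z0) (sym (+-identityˡ ℓ))))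

vertex₂ : ∀ d h → V₂ d h → (d , d - Marking.ℓ h) ∈ marked d h
vertex₂ d (marking ℓ _ _ _ _ _ _) (inj₁ refl) = there (here (cong (_, d - ℓ) (sum d ℓ)))
  where
  sum : ∀ d ℓ → d ≡ d - ℓ + ℓ
  sum = solve-∀
vertex₂ d (marking ℓ _ _ _ _ _ _) (inj₂ refl) = there (there (here (cong (d ,_) (sym (+-identityʳ (d - ℓ))))))

vertex₄ : ∀ d h → V₄ d h → (Marking.ℓ h , d) ∈ marked d h
vertex₄ d (marking ℓ _ _ _ _ _ _) (inj₁ refl) = there (there (there (here (cong (_, d) (sym (+-identityˡ ℓ))))))
vertex₄ d (marking ℓ _ _ _ _ _ _) (inj₂ refl) = there (there (there (there (here (cong (ℓ ,_) (sum d ℓ))))))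
  where
  sum : ∀ d ℓ → d ≡ ℓ + d - ℓ
  sum = solve-∀

-- Two non-adjacent marked vertices give the width in all three edge normals to four of the points,
-- which form a quadrilateral inscribed in a square.
pair₂₄ : ∀ {d} h → Valid d h → V₂ d h → V₄ d h → Contains d (marked d h)
pair₂₄ {d} h@(marking ℓ x₁ x₂ y₁ y₂ z₁ z₂) (valid hℓ hx₁ hx₂ hy₁ hy₂ hz₁ hz₂) v w = contains-⊆
  (⊆⇒⊆H (0th ∷ vertex₂ d h v ∷ vertex₄ d h w ∷ 5th ∷ []))
  (quad-contains (quad (within hℓ hx₁) hℓ (within (complement hℓ) hy₁) (complement hℓ)
    (inj₂ (inj₁ (proj₂ hy₁))) (inj₂ (inj₂ (inj₂ (≤-reflexive (sum d ℓ)))))))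
  where
  sum : ∀ d ℓ → ℓ + (d - ℓ) ≡ d
  sum = solve-∀

-- The vertical chord from (ℓ,0) to (ℓ,d) already has width d in both diagonal directions.
pair₁₄ : ∀ {d} h → Valid d h → V₁ d h → V₄ d h → Contains d (marked d h)
pair₁₄ {d} h@(marking ℓ x₁ x₂ y₁ y₂ z₁ z₂) (valid hℓ hx₁ hx₂ hy₁ hy₂ hz₁ hz₂) v w = contains-⊆
  (⊆⇒⊆H (vertex₁ d h v ∷ 2nd ∷ vertex₄ d h w ∷ 5th ∷ []))
  (quad-contains (quad hℓ hℓ (within (complement hℓ) hy₁) (shiftʸ′ hℓ hy₂) (inj₁ ≤-refl) (inj₁ ≤-refl)))

-- From here on rotation supplies the other pairs: those two apart come from `pair₂₄`, the opposite
-- one from `pair₁₄`.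
pair₁₃ : ∀ {d} h → Valid d h → V₁ d h → V₃ d h → Contains d (marked d h)
pair₁₃ {d} h ok v w = rotate-contains h (pair₂₄ (rotate d h) (rotate-valid h ok) (V₁→V₂ d h v) (V₃→V₄ d h w))

pair₀₂ : ∀ {d} h → Valid d h → V₀ d h → V₂ d h → Contains d (marked d h)
pair₀₂ {d} h ok v w = rotate-contains h (pair₁₃ (rotate d h) (rotate-valid h ok) (V₀→V₁ d h v) (V₂→V₃ d h w))

pair₅₁ : ∀ {d} h → Valid d h → V₅ d h → V₁ d h → Contains d (marked d h)
pair₅₁ {d} h ok v w = rotate-contains h (pair₀₂ (rotate d h) (rotate-valid h ok) (V₅→V₀ d h v) (V₁→V₂ d h w))

pair₄₀ : ∀ {d} h → Valid d h → V₄ d h → V₀ d h → Contains d (marked d h)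
pair₄₀ {d} h ok v w = rotate-contains h (pair₅₁ (rotate d h) (rotate-valid h ok) (V₄→V₅ d h v) (V₀→V₁ d h w))

pair₀₃ : ∀ {d} h → Valid d h → V₀ d h → V₃ d h → Contains d (marked d h)
pair₀₃ {d} h ok v w = rotate-contains h (pair₁₄ (rotate d h) (rotate-valid h ok) (V₀→V₁ d h v) (V₃→V₄ d h w))

-- A side with a lattice point in its interior has length at least 2, and both lengths ℓ and d - ℓ
-- occur.
side-range : ∀ {d ℓ x y} → In z1 (d - ℓ - z1) x → In z1 (ℓ - z1) y → In z2 (d - z2) ℓ
side-range {d} {ℓ} {x} {y} (h₁ , h₂) (h₃ , h₄) =
  lin (h₃ ⊞ h₄) (solve (ℓ ⨾ y ⨾ ∅)) , lin (h₁ ⊞ h₂) (solve (d ⨾ ℓ ⨾ x ⨾ ∅))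

-- Any third marked vertex is non-adjacent to one of these two. Without one, the marks on the three
-- sides away from this edge are interior, which is (T3).
edge₀₁ : ∀ {d} h → Valid d h → V₀ d h → V₁ d h → Contains d (marked d h)
edge₀₁ {d} h@(marking ℓ x₁ x₂ y₁ y₂ z₁ z₂) ok@(valid hℓ hx₁ hx₂ hy₁ hy₂ hz₁ hz₂) v₀ v₁
  with V₂? d h | V₃? d h | V₄? d h | V₅? d h
... | yes v | _ | _ | _ = pair₀₂ h ok v₀ v
... | no _ | yes v | _ | _ = pair₀₃ h ok v₀ v
... | no _ | no _ | yes v | _ = pair₄₀ h ok v v₀
... | no _ | no _ | no _ | yes v = pair₅₁ h ok v v₁
... | no ¬v₂ | no ¬v₃ | no ¬v₄ | no ¬v₅ =
  contains-form (inj₂ (inj₂ (inj₁ (ℓ , x₂ , y₂ , z₁ , side-range {d} {ℓ} {x₂} {y₂} ix₂ iy₂ , ix₂ , iy₂ , iz₁ , refl))))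
    (T3-wide hℓ hx₂ hy₂ hz₁)
    (⊆⇒⊆H (vertex₀ d h v₀ ∷ vertex₁ d h v₁ ∷ there (there (here (cong (d ,_) (swap d ℓ y₂)))) ∷ 3rd ∷ 4th ∷ []))
  where
  ix₂ : In z1 (d - ℓ - z1) x₂
  ix₂ = interior hx₂ (¬v₄ ∘ inj₁) (¬v₃ ∘ inj₂)
  iy₂ : In z1 (ℓ - z1) y₂
  iy₂ = interior hy₂ (¬v₂ ∘ inj₂) (¬v₃ ∘ inj₁)
  iz₁ : In z1 (ℓ - z1) z₁
  iz₁ = interior hz₁ (¬v₅ ∘ inj₁) (¬v₄ ∘ inj₂)
  swap : ∀ d ℓ y → y + d - ℓ ≡ d - ℓ + y
  swap = solve-∀

-- A second marked vertex is either adjacent, giving a marked edge up to rotation, or non-adjacent;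
-- without one the form is (T4).
corner₀ : ∀ {d} h → Valid d h → V₀ d h → Contains d (marked d h)
corner₀ {d} h@(marking ℓ x₁ x₂ y₁ y₂ z₁ z₂) ok@(valid hℓ hx₁ hx₂ hy₁ hy₂ hz₁ hz₂) v₀
  with V₁? d h | V₂? d h | V₃? d h | V₄? d h | V₅? d h
... | yes v | _ | _ | _ | _ = edge₀₁ h ok v₀ v
... | no _ | yes v | _ | _ | _ = pair₀₂ h ok v₀ v
... | no _ | no _ | yes v | _ | _ = pair₀₃ h ok v₀ v
... | no _ | no _ | no _ | yes v | _ = pair₄₀ h ok v v₀
... | no _ | no _ | no _ | no _ | yes v =
  rotate-contains h (edge₀₁ (rotate d h) (rotate-valid h ok) (V₅→V₀ d h v) (V₀→V₁ d h v₀))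
... | no ¬v₁ | no ¬v₂ | no ¬v₃ | no ¬v₄ | no ¬v₅ =
  contains-form (inj₂ (inj₂ (inj₂ (inj₁ (ℓ , x₂ , y₂ , z₁ , z₂ , side-range {d} {ℓ} {x₂} {y₂} ix₂ iy₂ ,
      iy₂ , iz₁ , ix₂ , iz₂ , refl)))))
    (T4-wide hℓ hx₂ hy₂ hz₁ hz₂)
    (⊆⇒⊆H (vertex₀ d h v₀ ∷ 1st ∷ there (there (here (cong (d ,_) (swap d ℓ y₂)))) ∷ 3rd ∷ 4th ∷ []))
  where
  ix₂ : In z1 (d - ℓ - z1) x₂
  ix₂ = interior hx₂ (¬v₄ ∘ inj₁) (¬v₃ ∘ inj₂)
  iy₂ : In z1 (ℓ - z1) y₂
  iy₂ = interior hy₂ (¬v₂ ∘ inj₂) (¬v₃ ∘ inj₁)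
  iz₁ : In z1 (ℓ - z1) z₁
  iz₁ = interior hz₁ (¬v₅ ∘ inj₁) (¬v₄ ∘ inj₂)
  iz₂ : In z1 (d - ℓ - z1) z₂
  iz₂ = interior hz₂ (¬v₁ ∘ inj₂) (¬v₂ ∘ inj₁)
  swap : ∀ d ℓ y → y + d - ℓ ≡ d - ℓ + y
  swap = solve-∀

corner₅ : ∀ {d} h → Valid d h → V₅ d h → Contains d (marked d h)
corner₅ {d} h ok v = rotate-contains h (corner₀ (rotate d h) (rotate-valid h ok) (V₅→V₀ d h v))

corner₄ : ∀ {d} h → Valid d h → V₄ d h → Contains d (marked d h)
corner₄ {d} h ok v = rotate-contains h (corner₅ (rotate d h) (rotate-valid h ok) (V₄→V₅ d h v))

corner₃ : ∀ {d} h → Valid d h → V₃ d h → Contains d (marked d h)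
corner₃ {d} h ok v = rotate-contains h (corner₄ (rotate d h) (rotate-valid h ok) (V₃→V₄ d h v))

corner₂ : ∀ {d} h → Valid d h → V₂ d h → Contains d (marked d h)
corner₂ {d} h ok v = rotate-contains h (corner₃ (rotate d h) (rotate-valid h ok) (V₂→V₃ d h v))

corner₁ : ∀ {d} h → Valid d h → V₁ d h → Contains d (marked d h)
corner₁ {d} h ok v = rotate-contains h (corner₂ (rotate d h) (rotate-valid h ok) (V₁→V₂ d h v))

hexagon-contains : ∀ {d} h → Valid d h → Contains d (marked d h)
hexagon-contains {d} h@(marking ℓ x₁ x₂ y₁ y₂ z₁ z₂) ok@(valid hℓ hx₁ hx₂ hy₁ hy₂ hz₁ hz₂)
  with V₀? d h | V₁? d h | V₂? d h | V₃? d h | V₄? d h | V₅? d h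
... | yes v | _ | _ | _ | _ | _ = corner₀ h ok v
... | no _ | yes v | _ | _ | _ | _ = corner₁ h ok v
... | no _ | no _ | yes v | _ | _ | _ = corner₂ h ok v
... | no _ | no _ | no _ | yes v | _ | _ = corner₃ h ok v
... | no _ | no _ | no _ | no _ | yes v | _ = corner₄ h ok v
... | no _ | no _ | no _ | no _ | no _ | yes v = corner₅ h ok v
... | no ¬v₀ | no ¬v₁ | no ¬v₂ | no ¬v₃ | no ¬v₄ | no ¬v₅ =
  contains-form (inj₂ (inj₂ (inj₂ (inj₂ (ℓ , x₁ , x₂ , y₁ , y₂ , z₁ , z₂ ,
      side-range {d} {ℓ} {x₂} {y₂} ix₂ iy₂ , ix₁ , iy₂ , iz₁ , ix₂ , iy₁ , iz₂ , refl)))))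
    (T5-wide hℓ hx₁ hx₂ hy₁ hy₂ hz₁ hz₂) ⊆H-refl
  where
  ix₁ : In z1 (ℓ - z1) x₁
  ix₁ = interior hx₁ (¬v₀ ∘ inj₁) (¬v₁ ∘ inj₁)
  ix₂ : In z1 (d - ℓ - z1) x₂
  ix₂ = interior hx₂ (¬v₄ ∘ inj₁) (¬v₃ ∘ inj₂)
  iy₁ : In z1 (d - ℓ - z1) y₁
  iy₁ = interior hy₁ (¬v₀ ∘ inj₂) (¬v₅ ∘ inj₂)
  iy₂ : In z1 (ℓ - z1) y₂
  iy₂ = interior hy₂ (¬v₂ ∘ inj₂) (¬v₃ ∘ inj₁)
  iz₁ : In z1 (ℓ - z1) z₁
  iz₁ = interior hz₁ (¬v₅ ∘ inj₁) (¬v₄ ∘ inj₂)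
  iz₂ : In z1 (d - ℓ - z1) z₂
  iz₂ = interior hz₂ (¬v₁ ∘ inj₂) (¬v₂ ∘ inj₁)

-- Columns of lattice points over the chord from (0,0) to (d,q)

mul⁺ : ∀ {k n} → z0 ≤ k → z0 ≤ n → z0 ≤ k * n
mul⁺ {k} {n} h h′ = lin (mul h h′) (solve (k ⨾ n ⨾ ∅))

-- The chord meets the column at height αq/d, rarely an integer. Its weight k d is therefore
-- distributed over the ends of the chord as k (d - α) and k α.
column-weights : ∀ {S d q α a y} k w → InHull S (z0 , z0) → InHull S (d , q) → InHull S (α , a) →
  z1 ≤ d → In z0 d α → z1 ≤ k → z0 ≤ w → (w + k * d) * y ≡ w * a + k * (α * q) → InHull S (α , y)
column-weights {S} {d} {q} {α} {a} {y} k w hP hQ hA 1≤d (0≤α , α≤d) 1≤k 0≤w e =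
  hull₃ (k * (d - α)) (k * α) w α y hP hQ hA
    (mul⁺ 0≤k (i≤j⇒0≤j-i α≤d)) (mul⁺ 0≤k 0≤α) 0≤w (total 1≤k 1≤d 0≤w)
    (eqˣ d α k w) (trans (spread-out d α y k w) (trans e (gather d q α a k w)))
  where
  0≤k = ≤-trans 0≤[ 1 ] 1≤k
  total : ∀ {d α k w} → z1 ≤ k → z1 ≤ d → z0 ≤ w → z1 ≤ k * (d - α) + k * α + w
  total {d} {α} {k} {w} h h′ h″ = lin (mul h h′ ⊞ h ⊞ h′ ⊞ h″) (solve (d ⨾ α ⨾ k ⨾ w ⨾ ∅))
  eqˣ : ∀ d α k w → (k * (d - α) + k * α + w) * α ≡ k * (d - α) * z0 + k * α * d + w * α
  eqˣ = solve-∀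
  spread-out : ∀ d α y k w → (k * (d - α) + k * α + w) * y ≡ (w + k * d) * y
  spread-out = solve-∀
  gather : ∀ d q α a k w → w * a + k * (α * q) ≡ k * (d - α) * z0 + k * α * q + w * a
  gather = solve-∀

column-above : ∀ {S d q α a y} → InHull S (z0 , z0) → InHull S (d , q) → InHull S (α , a) →
  z1 ≤ d → In z0 d α → y ≤ a → α * q ≤ d * y → InHull S (α , y)
column-above {S} {d} {q} {α} {a} {y} hP hQ hA 1≤d hα y≤a chord = [ same , lower ]′ (split a y)
  where
  same : a ≤ y → InHull S (α , y)
  same a≤y = subst (λ z → InHull S (α , z)) (≤-antisym a≤y y≤a) hA
  positive : ∀ {a y} → z1 + y ≤ a → z1 ≤ a - y
  positive {a} {y} h = lin h (solve (a ⨾ y ⨾ ∅))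
  identity : ∀ d q α a y → (d * y - α * q + (a - y) * d) * y ≡ (d * y - α * q) * a + (a - y) * (α * q)
  identity = solve-∀
  lower : z1 + y ≤ a → InHull S (α , y)
  -- Lever rule: the weights are the opposite distances a - y and y - αq/d, the latter multiplied by
  -- d as are the chord's.
  lower y<a = column-weights (a - y) (d * y - α * q) hP hQ hA 1≤d hα (positive y<a) (i≤j⇒0≤j-i chord) (identity d q α a y)

column-below : ∀ {S d q α a y} → InHull S (z0 , z0) → InHull S (d , q) → InHull S (α , a) →
  z1 ≤ d → In z0 d α → a ≤ y → d * y ≤ α * q → InHull S (α , y)
column-below {S} {d} {q} {α} {a} {y} hP hQ hA 1≤d hα a≤y chord = [ same , higher ]′ (split y a)
  where
  same : y ≤ a → InHull S (α , y)
  same y≤a = subst (λ z → InHull S (α , z)) (≤-antisym a≤y y≤a) hA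
  positive : ∀ {a y} → z1 + a ≤ y → z1 ≤ y - a
  positive {a} {y} h = lin h (solve (a ⨾ y ⨾ ∅))
  identity : ∀ d q α a y → (α * q - d * y + (y - a) * d) * y ≡ (α * q - d * y) * a + (y - a) * (α * q)
  identity = solve-∀
  higher : z1 + a ≤ y → InHull S (α , y)
  higher a<y = column-weights (y - a) (α * q - d * y) hP hQ hA 1≤d hα (positive a<y) (i≤j⇒0≤j-i chord) (identity d q α a y)

-- conv S meets the lines x = 0 and x = d in (0,0) and (d,q), the lines y = a, y = −b in
-- (α,a), (β,−b), and the lines y − x = c, y − x = −e in (γ,γ+c), (δ,δ−e).
record Strip (S : List Point) (d q α a β b γ c δ e : ℤ) : Set where
  field
    1≤d : z1 ≤ d
    hq  : In z0 d q
    hα  : In z0 d α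
    hβ  : In z0 d β
    hγ  : In z0 d γ
    hδ  : In z0 d δ
    -- From here to `β+b≤e`: none of the points P, Q, C, D passes A, B where this is used for y, and
    -- none of P, Q, A, B passes C, D where it is used for y - x.
    q≤a : q ≤ a
    0≤b : z0 ≤ b
    0≤c : z0 ≤ c
    d-q≤e : d - q ≤ e
    γ+c≤a : γ + c ≤ a
    a≤c+α : a ≤ c + α
    e≤b+δ : e ≤ b + δ
    β+b≤e : β + b ≤ e
    P : InHull S (z0 , z0)
    Q : InHull S (d , q)
    A : InHull S (α , a)
    B : InHull S (β , - b)
    C : InHull S (γ , γ + c)
    D : InHull S (δ , δ - e)

module _ {S : List Point} {d q α a β b γ c δ e : ℤ} (σ : Strip S d q α a β b γ c δ e) where
  open Strip σ

  -- On the chord 0 ≤ y ≤ q and q - d ≤ y - x ≤ 0. Each extreme point may thus move along its column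
  -- until its functional reaches the chord's own extreme value; the next three lemmas are the
  -- analogues.
  lower-A : ∀ {a′} → q ≤ a′ → a′ ≤ a → InHull S (α , a′)
  lower-A h h′ = column-above P Q A 1≤d hα h′ (chord {d} {q} {α} (mul (≤-trans 0≤[ 1 ] 1≤d) h) (mul (proj₁ hq) (proj₂ hα)))
    where
    chord : ∀ {d q α a} → z0 ≤ (d - z0) * (a - q) → z0 ≤ (q - z0) * (d - α) → α * q ≤ d * a
    chord {d} {q} {α} {a} h h′ = lin (h ⊞ h′) (solve (d ⨾ q ⨾ α ⨾ a ⨾ ∅))

  raise-B : ∀ {b′} → z0 ≤ b′ → b′ ≤ b → InHull S (β , - b′)
  raise-B h h′ = column-below P Q B 1≤d hβ (neg-mono-≤ h′) (chord {d} {q} {β} (mul⁺ (≤-trans 0≤[ 1 ] 1≤d) h) (mul⁺ (proj₁ hβ) (proj₁ hq)))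
    where
    chord : ∀ {d q β b} → z0 ≤ d * b → z0 ≤ β * q → d * - b ≤ β * q
    chord {d} {q} {β} {b} h h′ = lin (h ⊞ h′) (solve (d ⨾ q ⨾ β ⨾ b ⨾ ∅))

  lower-C : ∀ {c′} → z0 ≤ c′ → c′ ≤ c → InHull S (γ , γ + c′)
  lower-C h h′ = column-above P Q C 1≤d hγ (+-monoʳ-≤ γ h′) (chord {d} {q} {γ} (mul⁺ (≤-trans 0≤[ 1 ] 1≤d) h) (mul (proj₁ hγ) (proj₂ hq)))
    where
    chord : ∀ {d q γ c} → z0 ≤ d * c → z0 ≤ (γ - z0) * (d - q) → γ * q ≤ d * (γ + c)
    chord {d} {q} {γ} {c} h h′ = lin (h ⊞ h′) (solve (d ⨾ q ⨾ γ ⨾ c ⨾ ∅))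

  raise-D : ∀ {e′} → d - q ≤ e′ → e′ ≤ e → InHull S (δ , δ - e′)
  raise-D h h′ = column-below P Q D 1≤d hδ (flip≤ {δ} h′) (chord {d} {q} {δ} (mul (≤-trans 0≤[ 1 ] 1≤d) h) (mul (proj₂ hδ) (proj₂ hq)))
    where
    chord : ∀ {d q δ e} → z0 ≤ (d - z0) * (e - (d - q)) → z0 ≤ (d - δ) * (d - q) → d * (δ - e) ≤ δ * q
    chord {d} {q} {δ} {e} h h′ = lin (h ⊞ h′) (solve (d ⨾ q ⨾ δ ⨾ e ⨾ ∅))

  -- Each inequality relating two extreme points involves either A and C, which share s, or B and D,
  -- which share t, and so survives the move.
  shrink : ∀ s t → s ≤ a - q → s ≤ c → z0 ≤ s → z0 ≤ t → t ≤ b → t ≤ e - (d - q) →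
    Strip S d q α (a - s) β (b - t) γ (c - s) δ (e - t)
  shrink s t s≤a-q s≤c 0≤s 0≤t t≤b t≤e-[d-q] = record
    { 1≤d = 1≤d ; hq = hq ; hα = hα ; hβ = hβ ; hγ = hγ ; hδ = hδ
    ; q≤a = exchange {s} {a} {q} s≤a-q ; 0≤b = i≤j⇒0≤j-i t≤b ; 0≤c = i≤j⇒0≤j-i s≤c ; d-q≤e = exchange {t} {e} {d - q} t≤e-[d-q]
    ; γ+c≤a = both₁ {γ} {c} {a} γ+c≤a ; a≤c+α = both₂ {a} {c} {α} a≤c+α
    ; e≤b+δ = both₂ {e} {b} {δ} e≤b+δ ; β+b≤e = both₁ {β} {b} {e} β+b≤e
    ; P = P ; Q = Q
    ; A = lower-A (exchange {s} {a} {q} s≤a-q) (less {a} 0≤s) ; B = raise-B (i≤j⇒0≤j-i t≤b) (less {b} 0≤t)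
    ; C = lower-C (i≤j⇒0≤j-i s≤c) (less {c} 0≤s) ; D = raise-D (exchange {t} {e} {d - q} t≤e-[d-q]) (less {e} 0≤t) }
    where
    exchange : ∀ {x y z} → x ≤ y - z → z ≤ y - x
    exchange {x} {y} {z} h = lin h (solve (x ⨾ y ⨾ z ⨾ ∅))
    less : ∀ {x s} → z0 ≤ s → x - s ≤ x
    less {x} {s} h = lin h (solve (x ⨾ s ⨾ ∅))
    both₁ : ∀ {x y z s} → x + y ≤ z → x + (y - s) ≤ z - s
    both₁ {x} {y} {z} {s} h = lin h (solve (x ⨾ y ⨾ z ⨾ s ⨾ ∅))
    both₂ : ∀ {x y z s} → x ≤ y + z → x - s ≤ y - s + z
    both₂ {x} {y} {z} {s} h = lin h (solve (x ⨾ y ⨾ z ⨾ s ⨾ ∅))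

  Shifted : List Point
  Shifted = map (apply (translate (z0 , b))) S

  shift : ∀ {x y y′} → InHull S (x , y) → y′ ≡ y + b → InHull Shifted (x , y′)
  shift {x} {y} h refl = subst (InHull Shifted)
    (trans (apply-translate (z0 , b) (x , y)) (cong (_, y + b) (+-identityʳ x))) (hull-map (translate (z0 , b)) h)

  shifted-contains : ∀ {T} → T ⊆H Shifted → Contains d T → Contains d S
  shifted-contains h k = contains-map (translate (z0 , b)) (inj₁ refl) (contains-⊆ h k)

  module _ (a+b≡d : a + b ≡ d) where

    q+b≤d : q + b ≤ d
    q+b≤d = ≤-trans (+-monoˡ-≤ b q≤a) (≤-reflexive a+b≡d)

    -- The direction (1,1) takes care of itself: since q ≥ 0, the right-hand point is no lower than
    -- the left-hand one.
    quadrilateral-case : AntiDiagonal d β α b (q + b) → Contains d S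
    quadrilateral-case anti = shifted-contains
      (shift B (sym (+-inverseˡ b)) ∷ shift Q refl ∷ shift A (sym a+b≡d) ∷ shift P (sym (+-identityˡ b)) ∷ [])
      (quad-contains (quad hβ hα (0≤b , ≤-trans b≤q+b q+b≤d) (≤-trans 0≤b b≤q+b , q+b≤d) (inj₂ (inj₁ b≤q+b)) anti))
      where
      b≤q+b : b ≤ q + b
      b≤q+b = ≤-trans (≤-reflexive (sym (+-identityˡ b))) (+-monoˡ-≤ b (proj₁ hq))

    -- In coordinates with the bottom at y = 0, C and D move to y - x = d - ℓ and y - x = -ℓ, so c
    -- becomes d - ℓ - b and e becomes ℓ + b. The six bounds make these moves admissible and place
    -- every point on its side of the hexagon.
    hexagon-case : ∀ ℓ → β ≤ ℓ → d - (q + b) ≤ ℓ → d - (c + b) ≤ ℓ → ℓ ≤ α → ℓ ≤ d - b → ℓ ≤ e - b → Contains d S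
    hexagon-case ℓ β≤ℓ r≤ℓ n≤ℓ ℓ≤α ℓ≤d-b ℓ≤e-b = shifted-contains
      ( shift B (sym (+-inverseˡ b)) ∷ at-D ∷ shift Q (cancel₂ d ℓ (q + b)) ∷ at-A ∷ at-C
      ∷ shift P (sym (+-identityˡ b)) ∷ [])
      (hexagon-contains (marking ℓ β (α - ℓ) b (q + b - (d - ℓ)) γ (δ - ℓ))
        (valid (≤-trans (proj₁ hβ) β≤ℓ , ≤-trans ℓ≤α (proj₂ hα)) (proj₁ hβ , β≤ℓ)
          (i≤j⇒0≤j-i ℓ≤α , +-monoˡ-≤ (- ℓ) (proj₂ hα)) (0≤b , exchange {ℓ} {d} {b} ℓ≤d-b)
          (right₁ {d} {ℓ} {q + b} r≤ℓ , right₂ {d} {ℓ} {q + b} q+b≤d) (proj₁ hγ , upper {a} {b} {c} a+b≡d γ+c≤a n≤ℓ)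
          (lower {b} {δ} {e} ℓ≤e-b e≤b+δ , +-monoˡ-≤ (- ℓ) (proj₂ hδ))))
      where
      exchange : ∀ {x y z} → x ≤ y - z → z ≤ y - x
      exchange {x} {y} {z} h = lin h (solve (x ⨾ y ⨾ z ⨾ ∅))
      right₁ : ∀ {d ℓ r} → d - r ≤ ℓ → z0 ≤ r - (d - ℓ)
      right₁ {d} {ℓ} {r} h = lin h (solve (d ⨾ ℓ ⨾ r ⨾ ∅))
      right₂ : ∀ {d ℓ r} → r ≤ d → r - (d - ℓ) ≤ ℓ
      right₂ {d} {ℓ} {r} h = lin h (solve (d ⨾ ℓ ⨾ r ⨾ ∅))
      upper : ∀ {a b c d γ ℓ} → a + b ≡ d → γ + c ≤ a → d - (c + b) ≤ ℓ → γ ≤ ℓ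
      upper {a} {b} {c} {_} {γ} {ℓ} refl h h′ = lin (h ⊞ h′) (solve (a ⨾ b ⨾ c ⨾ γ ⨾ ℓ ⨾ ∅))
      lower : ∀ {b δ e ℓ} → ℓ ≤ e - b → e ≤ b + δ → z0 ≤ δ - ℓ
      lower {b} {δ} {e} {ℓ} h h′ = lin (h ⊞ h′) (solve (b ⨾ δ ⨾ e ⨾ ℓ ⨾ ∅))
      cancel₂ : ∀ d ℓ r → d - ℓ + (r - (d - ℓ)) ≡ r
      cancel₂ = solve-∀
      restore : ∀ x ℓ → x ≡ x - ℓ + ℓ
      restore = solve-∀
      at-A : InHull Shifted (α - ℓ + ℓ , d)
      at-A = subst (λ x → InHull Shifted (x , d)) (restore α ℓ) (shift A (sym a+b≡d))
      at-C : InHull Shifted (γ , γ + d - ℓ)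
      at-C = shift (lower-C (above {d} {ℓ} {b} ℓ≤d-b) (below {d} {ℓ} {b} n≤ℓ)) (height γ d ℓ b)
        where
        above : ∀ {d ℓ b} → ℓ ≤ d - b → z0 ≤ d - ℓ - b
        above {d} {ℓ} {b} h = lin h (solve (d ⨾ ℓ ⨾ b ⨾ ∅))
        below : ∀ {d ℓ b c} → d - (c + b) ≤ ℓ → d - ℓ - b ≤ c
        below {d} {ℓ} {b} {c} h = lin h (solve (d ⨾ ℓ ⨾ b ⨾ c ⨾ ∅))
        height : ∀ γ d ℓ b → γ + d - ℓ ≡ γ + (d - ℓ - b) + b
        height = solve-∀
      at-D : InHull Shifted (δ - ℓ + ℓ , δ - ℓ)
      at-D = subst (λ x → InHull Shifted (x , δ - ℓ)) (restore δ ℓ)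
        (shift (raise-D (above {d} {ℓ} {b} r≤ℓ) (below {ℓ} {b} ℓ≤e-b)) (height δ ℓ b))
        where
        above : ∀ {d ℓ b q} → d - (q + b) ≤ ℓ → d - q ≤ ℓ + b
        above {d} {ℓ} {b} {q} h = lin h (solve (d ⨾ ℓ ⨾ b ⨾ q ⨾ ∅))
        below : ∀ {ℓ b e} → ℓ ≤ e - b → ℓ + b ≤ e
        below {ℓ} {b} {e} h = lin h (solve (ℓ ⨾ b ⨾ e ⨾ ∅))
        height : ∀ δ ℓ b → δ - ℓ ≡ δ - (ℓ + b) + b
        height = solve-∀

-- The greatest lower bound given serves; being an integer, it keeps the moved points in the
-- lattice.
between : ∀ {l₁ l₂ l₃ u₁ u₂ u₃} →
  l₁ ≤ u₁ → l₁ ≤ u₂ → l₁ ≤ u₃ → l₂ ≤ u₁ → l₂ ≤ u₂ → l₂ ≤ u₃ → l₃ ≤ u₁ → l₃ ≤ u₂ → l₃ ≤ u₃ →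
  ∃ λ m → (l₁ ≤ m) × (l₂ ≤ m) × (l₃ ≤ m) × (m ≤ u₁) × (m ≤ u₂) × (m ≤ u₃)
between {l₁} {l₂} {l₃} h₁₁ h₁₂ h₁₃ h₂₁ h₂₂ h₂₃ h₃₁ h₃₂ h₃₃ =
  l₁ ⊔ l₂ ⊔ l₃
  , ≤-trans (i≤i⊔j l₁ l₂) (i≤i⊔j (l₁ ⊔ l₂) l₃) , ≤-trans (i≤j⊔i l₁ l₂) (i≤i⊔j (l₁ ⊔ l₂) l₃) , i≤j⊔i (l₁ ⊔ l₂) l₃
  , ⊔-lub (⊔-lub h₁₁ h₂₁) h₃₁ , ⊔-lub (⊔-lub h₁₂ h₂₂) h₃₂ , ⊔-lub (⊔-lub h₁₃ h₂₃) h₃₃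

antiDiagonal? : ∀ d x₁ x₂ y₁ y₂ → AntiDiagonal d x₁ x₂ y₁ y₂
  ⊎ (z1 + x₁ ≤ x₂) × (z1 + y₁ ≤ y₂) × (z1 + (x₁ + y₁) ≤ d) × (z1 + d ≤ x₂ + y₂)
antiDiagonal? d x₁ x₂ y₁ y₂ with split x₂ x₁ | split y₂ y₁ | split d (x₁ + y₁) | split (x₂ + y₂) d
... | inj₁ h | _ | _ | _ = inj₁ (inj₁ h)
... | inj₂ _ | inj₁ h | _ | _ = inj₁ (inj₂ (inj₁ h))
... | inj₂ _ | inj₂ _ | inj₁ h | _ = inj₁ (inj₂ (inj₂ (inj₁ h)))
... | inj₂ _ | inj₂ _ | inj₂ _ | inj₁ h = inj₁ (inj₂ (inj₂ (inj₂ h)))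
... | inj₂ a | inj₂ b | inj₂ c | inj₂ e = inj₂ (a , b , c , e)

-- If the quadrilateral is too thin along y - x, the four strict inequalities expressing this are
-- four of the nine needed for ℓ. The others come from the strip, the height d and `d ≤ c + e`.
square-case : ∀ {S d q α a β b γ c δ e} → Strip S d q α a β b γ c δ e → a + b ≡ d → d ≤ c + e → Contains d S
square-case {S} {d} {q} {α} {a} {β} {b} {γ} {c} {δ} {e} σ a+b≡d d≤c+e =
  [ quadrilateral-case σ a+b≡d , hexagonal ]′ (antiDiagonal? d β α b (q + b))
  where
  open Strip σ
  weaken : ∀ {x y} → z1 + x ≤ y → x ≤ y
  weaken {x} {y} h = lin (h ⊞ 0≤[ 1 ]) (solve (x ⨾ y ⨾ ∅))
  l₁₂ : ∀ {d β b} → z1 + (β + b) ≤ d → β ≤ d - b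
  l₁₂ {d} {β} {b} h = lin (h ⊞ 0≤[ 1 ]) (solve (d ⨾ β ⨾ b ⨾ ∅))
  l₁₃ : ∀ {β b e} → β + b ≤ e → β ≤ e - b
  l₁₃ {β} {b} {e} h = lin h (solve (β ⨾ b ⨾ e ⨾ ∅))
  l₂₁ : ∀ {d α r} → z1 + d ≤ α + r → d - r ≤ α
  l₂₁ {d} {α} {r} h = lin (h ⊞ 0≤[ 1 ]) (solve (d ⨾ α ⨾ r ⨾ ∅))
  l₂₃ : ∀ {d q b e} → d - q ≤ e → d - (q + b) ≤ e - b
  l₂₃ {d} {q} {b} {e} h = lin h (solve (d ⨾ q ⨾ b ⨾ e ⨾ ∅))
  l₃₁ : ∀ {d α a b c} → a + b ≡ d → a ≤ c + α → d - (c + b) ≤ α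
  l₃₁ {_} {α} {a} {b} {c} refl h = lin h (solve (α ⨾ a ⨾ b ⨾ c ⨾ ∅))
  l₃₂ : ∀ {d b c} → z0 ≤ c → d - (c + b) ≤ d - b
  l₃₂ {d} {b} {c} h = lin h (solve (d ⨾ b ⨾ c ⨾ ∅))
  l₃₃ : ∀ {d b c e} → d ≤ c + e → d - (c + b) ≤ e - b
  l₃₃ {d} {b} {c} {e} h = lin h (solve (d ⨾ b ⨾ c ⨾ e ⨾ ∅))
  hexagonal : (z1 + β ≤ α) × (z1 + b ≤ q + b) × (z1 + (β + b) ≤ d) × (z1 + d ≤ α + (q + b)) → Contains d S
  hexagonal (β<α , b<q+b , h , h′) =
    let ℓ , k₁ , k₂ , k₃ , k₄ , k₅ , k₆ = between
          (weaken β<α) (l₁₂ {d} {β} h) (l₁₃ {β} β+b≤e)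
          (l₂₁ {d} {α} {q + b} h′) (flip≤ {d} (weaken b<q+b)) (l₂₃ {d} {q} {b} d-q≤e)
          (l₃₁ {d} {α} {a} {b} {c} a+b≡d a≤c+α) (l₃₂ {d} {b} {c} 0≤c) (l₃₃ {d} {b} {c} {e} d≤c+e)
    in hexagon-case σ a+b≡d ℓ k₁ k₂ k₃ k₄ k₅ k₆

-- Moving A, C down by s and B, D up by t with s + t = a + b − d shrinks the height to d.
strip-case₁ : ∀ {S d q α a β b γ c δ e} → Strip S d q α a β b γ c δ e →
  d ≤ a + b → a + b ≤ c + e → Contains d S
strip-case₁ {S} {d} {q} {α} {a} {β} {b} {γ} {c} {δ} {e} σ d≤a+b a+b≤c+e = conclude
  -- The bounds on s are the hypotheses of `shrink` with t = a + b - d - s.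
  (between {z0} {a - d} {a + b - d - (e - (d - q))} {a + b - d} {a - q} {c}
    (i≤j⇒0≤j-i d≤a+b) (i≤j⇒0≤j-i q≤a) 0≤c
    (l₂₁ {a} {b} {d} 0≤b) (flip≤ {a} (proj₂ hq)) (l₂₃ {a} {d} {c} {α} a≤c+α (proj₂ hα))
    (l₃₁ {d - q} {e} {a + b - d} d-q≤e) (l₃₂ {d} {q} {a} {b} {e} b≤e) (l₃₃ {d} {q} {a} {b} {c} {e} a+b≤c+e (proj₁ hq)))
  where
  open Strip σ
  b≤e : b ≤ e
  b≤e = ≤-trans (drop (proj₁ hβ)) β+b≤e
    where
    drop : ∀ {β b} → z0 ≤ β → b ≤ β + b
    drop {β} {b} h = lin h (solve (β ⨾ b ⨾ ∅))
  l₂₁ : ∀ {a b d} → z0 ≤ b → a - d ≤ a + b - d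
  l₂₁ {a} {b} {d} h = lin h (solve (a ⨾ b ⨾ d ⨾ ∅))
  l₂₃ : ∀ {a d c α} → a ≤ c + α → α ≤ d → a - d ≤ c
  l₂₃ {a} {d} {c} {α} h h′ = lin (h ⊞ h′) (solve (a ⨾ d ⨾ c ⨾ α ⨾ ∅))
  l₃₁ : ∀ {r e m} → r ≤ e → m - (e - r) ≤ m
  l₃₁ {r} {e} {m} h = lin h (solve (r ⨾ e ⨾ m ⨾ ∅))
  l₃₂ : ∀ {d q a b e} → b ≤ e → a + b - d - (e - (d - q)) ≤ a - q
  l₃₂ {d} {q} {a} {b} {e} h = lin h (solve (d ⨾ q ⨾ a ⨾ b ⨾ e ⨾ ∅))
  l₃₃ : ∀ {d q a b c e} → a + b ≤ c + e → z0 ≤ q → a + b - d - (e - (d - q)) ≤ c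
  l₃₃ {d} {q} {a} {b} {c} {e} h h′ = lin (h ⊞ h′) (solve (d ⨾ q ⨾ a ⨾ b ⨾ c ⨾ e ⨾ ∅))
  upper₂ : ∀ {a b d s} → a - d ≤ s → a + b - d - s ≤ b
  upper₂ {a} {b} {d} {s} h = lin h (solve (a ⨾ b ⨾ d ⨾ s ⨾ ∅))
  swap : ∀ {m n s} → m - n ≤ s → m - s ≤ n
  swap {m} {n} {s} h = lin h (solve (m ⨾ n ⨾ s ⨾ ∅))
  height : ∀ a b d s → a - s + (b - (a + b - d - s)) ≡ d
  height = solve-∀
  width : ∀ {a b c d e s} → a + b ≤ c + e → d ≤ c - s + (e - (a + b - d - s))
  width {a} {b} {c} {d} {e} {s} h = lin h (solve (a ⨾ b ⨾ c ⨾ d ⨾ e ⨾ s ⨾ ∅))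
  conclude : (∃ λ s → (z0 ≤ s) × (a - d ≤ s) × (a + b - d - (e - (d - q)) ≤ s) × (s ≤ a + b - d) × (s ≤ a - q) × (s ≤ c)) →
    Contains d S
  conclude (s , 0≤s , h₁ , h₂ , h₃ , s≤a-q , s≤c) = square-case
    (shrink σ s (a + b - d - s) s≤a-q s≤c 0≤s (i≤j⇒0≤j-i h₃) (upper₂ {a} {b} {d} h₁) (swap {a + b - d} h₂))
    (height a b d s) (width {a} {b} {c} {d} {e} {s} a+b≤c+e)

-- Exchanges the functionals y and x − y.
swapping : Affine
swapping = affine z1 z0 z1 (- z1) z0 z0

-- The new second coordinate is x - y, which turns minima of y - x into maxima: D takes the role of
-- A, C that of B, and conversely.
strip-swap : ∀ {S d q α a β b γ c δ e} → Strip S d q α a β b γ c δ e →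
  Strip (map (apply swapping) S) d (d - q) δ e γ c β b α a
strip-swap {S} {d} {q} {α} {a} {β} {b} {γ} {c} {δ} {e} σ = record
  { 1≤d = 1≤d ; hq = complement hq ; hα = hδ ; hβ = hγ ; hγ = hβ ; hδ = hα
  ; q≤a = d-q≤e ; 0≤b = 0≤c ; 0≤c = 0≤b ; d-q≤e = subst (_≤ a) (involutive d q) q≤a
  ; γ+c≤a = β+b≤e ; a≤c+α = e≤b+δ ; e≤b+δ = a≤c+α ; β+b≤e = γ+c≤a
  ; P = image P refl ; Q = image Q refl ; A = image D (involutive δ e) ; B = image C (down γ c)
  ; C = image B (up β b) ; D = image A refl }
  where
  open Strip σ
  down : ∀ γ c → - c ≡ γ - (γ + c)
  down = solve-∀
  up : ∀ β b → β + b ≡ β - - b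
  up = solve-∀
  first : ∀ x y → z1 * x + z0 * y + z0 ≡ x
  first = solve-∀
  second : ∀ x y → z1 * x + - z1 * y + z0 ≡ x - y
  second = solve-∀
  image : ∀ {x y y′} → InHull S (x , y) → y′ ≡ x - y → InHull (map (apply swapping) S) (x , y′)
  image {x} {y} h refl = subst (InHull (map (apply swapping) S)) (cong₂ _,_ (first x y) (second x y)) (hull-map swapping h)

-- The smaller of the two widths is the one to bring down to d, so that the other stays at least d.
strip-contains : ∀ {S d q α a β b γ c δ e} → Strip S d q α a β b γ c δ e →
  d ≤ a + b → d ≤ c + e → Contains d S
strip-contains {S} {d} {q} {α} {a} {β} {b} {γ} {c} {δ} {e} σ h h′ = [ strip-case₁ σ h , other ]′ (≤-total (a + b) (c + e))
  where
  other : c + e ≤ a + b → Contains d S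
  other k = contains-map swapping (inj₂ refl)
    (strip-case₁ (strip-swap σ) (subst (d ≤_) (+-comm c e) h′) (subst₂ _≤_ (+-comm c e) (+-comm a b) k))

-- From an arbitrary polygon to a strip

extent : ∀ {d S} v (f : Point → ℤ) {hi lo} → ¬ (S ≡ []) → (∀ p q → spread v p q ≡ f p - f q) →
  d ≤ lwDir v S → All (λ p → f p ≤ hi) S → All (λ p → lo ≤ f p) S → d ≤ hi - lo
extent {d} {S} v f ne h d≤lw above below with lwDir-attained v S ne
... | p , q , i , j , e = ≤-trans d≤lw (≤-trans (≤-reflexive (trans e (h p q)))
  (+-mono-≤ (All.lookup above i) (neg-mono-≤ (All.lookup below j))))

spread-vertical : ∀ p q → spread (+ 0 , + 1) p q ≡ proj₂ p - proj₂ q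
spread-vertical (x , y) (x′ , y′) = ring x y x′ y′
  where
  ring : ∀ x y x′ y′ → x * + 0 + y * + 1 - (x′ * + 0 + y′ * + 1) ≡ y - y′
  ring = solve-∀

ascent : Point → ℤ
ascent (x , y) = y - x

spread-antidiagonal : ∀ p q → spread (- (+ 1) , + 1) p q ≡ ascent p - ascent q
spread-antidiagonal (x , y) (x′ , y′) = ring x y x′ y′
  where
  ring : ∀ x y x′ y′ → x * - (+ 1) + y * + 1 - (x′ * - (+ 1) + y′ * + 1) ≡ y - x - (y′ - x′)
  ring = solve-∀

reduced-contains : ∀ {S d q} → z1 ≤ d → In z0 d q → (∀ v → Primitive v → d ≤ lwDir v S) →
  All (λ p → In z0 d (proj₁ p)) S → (z0 , z0) ∈ S → (d , q) ∈ S → Contains d S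
reduced-contains {S} {d} {q} 1≤d hq wide strip P Q = conclude
  (argmax proj₂ S ne) (argmin proj₂ S ne) (argmax ascent S ne) (argmin ascent S ne)
  where
  ne = nonempty P
  restore : ∀ γ c → c ≡ γ + (c - γ)
  restore = solve-∀
  restore′ : ∀ δ e → e ≡ δ - (δ - e)
  restore′ = solve-∀
  minus-neg : ∀ x → x ≡ - - x
  minus-neg = solve-∀
  neg-≥0 : ∀ {b} → b ≤ z0 → z0 ≤ - b
  neg-≥0 {b} h = lin h (solve (b ⨾ ∅))
  descend : ∀ {d q δ e} → e - δ ≤ q - d → d - q ≤ δ - e
  descend {d} {q} {δ} {e} h = lin h (solve (d ⨾ q ⨾ δ ⨾ e ⨾ ∅))
  f₁ : ∀ {a γ c} → c ≤ a → γ + (c - γ) ≤ a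
  f₁ {a} {γ} {c} h = lin h (solve (a ⨾ γ ⨾ c ⨾ ∅))
  f₂ : ∀ {α a γ c} → a - α ≤ c - γ → a ≤ c - γ + α
  f₂ {α} {a} {γ} {c} h = lin h (solve (α ⨾ a ⨾ γ ⨾ c ⨾ ∅))
  f₃ : ∀ {b δ e} → b ≤ e → δ - e ≤ - b + δ
  f₃ {b} {δ} {e} h = lin h (solve (b ⨾ δ ⨾ e ⨾ ∅))
  f₄ : ∀ {β b δ e} → e - δ ≤ b - β → β + - b ≤ δ - e
  f₄ {β} {b} {δ} {e} h = lin h (solve (β ⨾ b ⨾ δ ⨾ e ⨾ ∅))
  rewidth : ∀ {d γ c δ e} → d ≤ c - γ - (e - δ) → d ≤ c - γ + (δ - e)
  rewidth {d} {γ} {c} {δ} {e} h = lin h (solve (d ⨾ γ ⨾ c ⨾ δ ⨾ e ⨾ ∅))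
  conclude : (∃ λ p → p ∈ S × All (λ r → proj₂ r ≤ proj₂ p) S × (maxL (map proj₂ S) ≡ proj₂ p)) →
    (∃ λ p → p ∈ S × All (λ r → proj₂ p ≤ proj₂ r) S × (minL (map proj₂ S) ≡ proj₂ p)) →
    (∃ λ p → p ∈ S × All (λ r → ascent r ≤ ascent p) S × (maxL (map ascent S) ≡ ascent p)) →
    (∃ λ p → p ∈ S × All (λ r → ascent p ≤ ascent r) S × (minL (map ascent S) ≡ ascent p)) → Contains d S
  conclude ((α , a) , A , maxA , _) ((β , b) , B , minB , _) ((γ , c) , C , maxC , _) ((δ , e) , D , minD , _) =
    -- Here b, c and e are plain second coordinates, whereas the strip stores the levels y = -b, y -
    -- x = c and y - x = -e.
    strip-contains {S} {d} {q} {α} {a} {β} { - b} {γ} {c - γ} {δ} {δ - e} (record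
      { 1≤d = 1≤d ; hq = hq
      ; hα = All.lookup strip A ; hβ = All.lookup strip B ; hγ = All.lookup strip C ; hδ = All.lookup strip D
      ; q≤a = All.lookup maxA Q ; 0≤b = neg-≥0 (All.lookup minB P) ; 0≤c = All.lookup maxC P
      ; d-q≤e = descend {d} {q} {δ} {e} (All.lookup minD Q)
      ; γ+c≤a = f₁ {a} {γ} {c} (All.lookup maxA C) ; a≤c+α = f₂ {α} {a} {γ} {c} (All.lookup maxC A)
      ; e≤b+δ = f₃ {b} {δ} {e} (All.lookup minB D) ; β+b≤e = f₄ {β} {b} {δ} {e} (All.lookup minD B)
      ; P = ∈⇒hull P ; Q = ∈⇒hull Q ; A = ∈⇒hull A
      ; B = subst (λ y → InHull S (β , y)) (minus-neg b) (∈⇒hull B)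
      ; C = subst (λ y → InHull S (γ , y)) (restore γ c) (∈⇒hull C)
      ; D = subst (λ y → InHull S (δ , y)) (restore′ δ e) (∈⇒hull D) })
      (extent (+ 0 , + 1) proj₂ ne spread-vertical (wide (+ 0 , + 1) refl) maxA minB)
      (rewidth {d} {γ} {c} {δ} {e}
        (extent (- (+ 1) , + 1) ascent ne spread-antidiagonal (wide (- (+ 1) , + 1) refl) maxC minD))

unshear : ℤ → Affine
unshear k = affine z1 z0 (- k) z1 z0 z0

unsheared : ∀ k x y {y′} → y ≡ y′ + k * x → apply (unshear k) (x , y) ≡ (x , y′)
unsheared k x _ {y′} refl = cong₂ _,_ (first k x y′) (second k x y′)
  where
  first : ∀ k x y → z1 * x + z0 * (y + k * x) + z0 ≡ x
  first = solve-∀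
  second : ∀ k x y → - k * x + z1 * (y + k * x) + z0 ≡ y
  second = solve-∀

strip-point-contains : ∀ {S n y} → IsLw S (+ suc n) → All (λ p → In z0 (+ suc n) (proj₁ p)) S →
  (z0 , z0) ∈ S → (+ suc n , y) ∈ S → Contains (+ suc n) S
strip-point-contains {S} {n} {y} lw strip P Q = contains-map φ unimodular
  (reduced-contains (+≤+ (s≤s z≤n)) (0≤[ _ ] , +≤+ (ℕ.<⇒≤ (n%ℕd<d y (suc n)))) (proj₂ (lw-map φ unimodular (nonempty P) lw))
    (All.map⁺ (All.map (λ {p} → subst (In z0 (+ suc n)) (sym (keeps p))) strip))
    (subst (_∈ map (apply φ) S) (unsheared k z0 z0 (zero k)) (∈-map⁺ (apply φ) P))
    (subst (_∈ map (apply φ) S) (unsheared k (+ suc n) y (a≡a%ℕn+[a/ℕn]*n y (suc n))) (∈-map⁺ (apply φ) Q)))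
  where
  k = y /ℕ suc n
  φ = unshear k
  unit : ∀ k → z1 * z1 - z0 * - k ≡ + 1
  unit = solve-∀
  unimodular : Unimodular φ
  unimodular = inj₁ (unit k)
  zero : ∀ k → z0 ≡ z0 + k * z0
  zero = solve-∀
  keeps : ∀ p → proj₁ (apply φ p) ≡ proj₁ p
  keeps (x , y) = first x y
    where
    first : ∀ x y → z1 * x + z0 * y + z0 ≡ x
    first = solve-∀

-- The second row completes v to a basis; lo goes to the origin.
straighten : Point → Point → Point → Affine
straighten v@(m , n) (r , s) lo@(x , y) = affine m n (- s) r (- ⟪ lo , v ⟫) (- (- s * x + r * y))

straighten-unimodular : ∀ v u lo → ⟪ v , u ⟫ ≡ + 1 → Unimodular (straighten v u lo)
straighten-unimodular (m , n) (r , s) (x , y) e = inj₁ (trans (ring m n r s) e)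
  where
  ring : ∀ m n r s → m * r - n * - s ≡ m * r + n * s
  ring = solve-∀

straighten-proj₁ : ∀ v u lo p → proj₁ (apply (straighten v u lo) p) ≡ spread v p lo
straighten-proj₁ (m , n) (r , s) (x₀ , y₀) (x , y) = ring m n x y refl
  where
  ring : ∀ m n x y {k} → k ≡ x₀ * m + y₀ * n → m * x + n * y + - k ≡ x * m + y * n - k
  ring m n x y {k} refl = cong (_- k) (swap m n x y)
    where
    swap : ∀ m n x y → m * x + n * y ≡ x * m + y * n
    swap = solve-∀

straighten-origin : ∀ v u lo → apply (straighten v u lo) lo ≡ (z0 , z0)
straighten-origin v u@(r , s) lo@(x , y) = cong₂ _,_ (trans (straighten-proj₁ v u lo lo) (+-inverseʳ ⟪ lo , v ⟫)) (+-inverseʳ (- s * x + r * y))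

contains : ∀ {S d} → ¬ (S ≡ []) → IsLw S d → Contains d S
contains {S} {d} ne lw@((v , prim , lw≡d) , _) = conclude
  (primitive⇒bezout v prim) (argmax (λ p → ⟪ p , v ⟫) S ne) (argmin (λ p → ⟪ p , v ⟫) S ne)
  where
  width-cases : ∀ {T y} d → z0 ≤ d → IsLw T d → All (λ p → In z0 d (proj₁ p)) T →
    (z0 , z0) ∈ T → (d , y) ∈ T → Contains d T
  -- Width 0 admits no division by d, but (0,0) taken three times is already (T1).
  width-cases (+ 0) _ _ _ i _ = T1-contained (≤-refl , ≤-refl) (≤-refl , ≤-refl) ≤-refl i i i
  width-cases (+ suc n) _ lw strip i j = strip-point-contains lw strip i j
  conclude : Bezout v →
    (∃ λ p → p ∈ S × All (λ q → ⟪ q , v ⟫ ≤ ⟪ p , v ⟫) S × (maxL (map (λ p → ⟪ p , v ⟫) S) ≡ ⟪ p , v ⟫)) →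
    (∃ λ p → p ∈ S × All (λ q → ⟪ p , v ⟫ ≤ ⟪ q , v ⟫) S × (minL (map (λ p → ⟪ p , v ⟫) S) ≡ ⟪ p , v ⟫)) →
    Contains d S
  conclude (u , e) (hi , i , max , e₁) (lo , j , min , e₂) = contains-map φ uφ
    (width-cases d (subst (z0 ≤_) reach (i≤j⇒0≤j-i (All.lookup min i))) (lw-map φ uφ ne lw)
      (All.map⁺ (All.zipWith (λ {p} (h , h′) → subst (In z0 d) (sym (straighten-proj₁ v u lo p))
          (i≤j⇒0≤j-i h , subst (spread v p lo ≤_) reach (+-monoˡ-≤ (- ⟪ lo , v ⟫) h′))) (min , max)))
      (subst (_∈ map (apply φ) S) (straighten-origin v u lo) (∈-map⁺ (apply φ) j))
      (subst (_∈ map (apply φ) S) (cong (_, proj₂ (apply φ hi)) (trans (straighten-proj₁ v u lo hi) reach)) (∈-map⁺ (apply φ) i)))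
    where
    φ = straighten v u lo
    uφ = straighten-unimodular v u lo e
    reach : spread v hi lo ≡ d
    reach = trans (sym (cong₂ _-_ e₁ e₂)) lw≡d

theorem2p4 : (S : List Point) → ¬ (S ≡ []) → Minimal S → (d : ℤ) → IsLw S d →
    ∃ λ (T : List Point) → Minimal T × Equivalent S T × OfForm d T
theorem2p4 S ne min d lw = contains⇒classified S ne min d lw (contains ne lw)
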